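{- Let $q>2$ be a prime power, $n$ a positive integer and $F=\mathbb{F}_{q^{2n+1}}$. Let $\alpha=-1$ if $q$ is odd and let $\alpha$ be any element of $\mathbb{F}_q\setminus\{0,1\}$ if $q$ is even. Consider the projective space $\mathrm{PG}(4n+1,q)$ whose points are the $1$-dimensional $\mathbb{F}_q$-subspaces of the $\mathbb{F}_q$-vector space $F\times F$; write $P(a,b)$ for the point spanned by $(a,b)\ne(0,0)$. For $\omega\in F^*$ let $\mathcal{V}_\omega=\{P(x^2,\omega x^{q+1}):x\in F^*\}$. Then $\mathcal{V}_1\cup\mathcal{V}_\alpha$ is a complete cap of $\mathrm{PG}(4n+1,q)$ of size $2(q^{2n+1}-1)/(q-1)$.
   Context: A cap is a set of points no three of which are collinear; it is complete if it is not contained in a strictly larger cap. -}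

module Defs where

open import Level using (0ℓ)
open import Data.Nat as ℕ using (ℕ; zero; suc)
open import Data.Nat.Primality using (Prime)
open import Data.Fin using (Fin)
open import Data.Product using (Σ; ∃; ∃-syntax; _×_; _,_; proj₁; proj₂)
open import Data.Sum using (_⊎_)
open import Data.List using (List; length)
open import Data.List.Relation.Unary.All using (All)
open import Data.List.Relation.Unary.Any using (Any)
open import Data.List.Relation.Unary.AllPairs using (AllPairs)
open import Relation.Nullary using (¬_; Dec)
open import Relation.Binary.PropositionalEquality using (_≡_; _≢_)
open import Algebra.Structures using (IsCommutativeRing)
open import Function.Bundles using (_↔_)

IsPrimePower : ℕ → Set
IsPrimePower q = ∃[ p ] ∃[ k ] (Prime p × q ≡ p ℕ.^ suc k)

record FiniteField : Set₁ where
  infixl 6 _+_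
  infixl 7 _*_
  field
    Carrier : Set
    _+_ _*_ : Carrier → Carrier → Carrier
    -_      : Carrier → Carrier
    0# 1#   : Carrier
    isCommutativeRing : IsCommutativeRing _≡_ _+_ _*_ -_ 0# 1#
    0≢1     : 0# ≢ 1#
    inverse : ∀ x → x ≢ 0# → ∃[ y ] (x * y ≡ 1#)
    _≟_     : (x y : Carrier) → Dec (x ≡ y)
    card    : ℕ
    enum    : Carrier ↔ Fin card

  _^_ : Carrier → ℕ → Carrier
  x ^ zero  = 1#
  x ^ suc k = x * (x ^ k)

-- Geometry of PG(4n+1,q) realised on the F_q-vector space F × F, where
-- F has q^(2n+1) elements and F_q = { x ∈ F : x^q = x }.
module Geometry (F : FiniteField) (q : ℕ) where
  open FiniteField F

  InK : Carrier → Set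
  InK x = x ^ q ≡ x

  V : Set
  V = Carrier × Carrier

  zeroV : V
  zeroV = 0# , 0#

  _⊕_ : V → V → V
  (a , b) ⊕ (c , d) = (a + c) , (b + d)

  _·_ : Carrier → V → V
  λ₀ · (a , b) = (λ₀ * a) , (λ₀ * b)

  _∼_ : V → V → Set
  u ∼ v = ∃[ c ] (InK c × c ≢ 0# × v ≡ c · u)

  Dependent : V → V → V → Set
  Dependent u v w = ∃[ a ] ∃[ b ] ∃[ c ]
    (InK a × InK b × InK c × ¬ (a ≡ 0# × b ≡ 0# × c ≡ 0#) ×
     ((a · u) ⊕ (b · v)) ⊕ (c · w) ≡ zeroV)

  -- a set of points given by a predicate on nonzero vectors
  -- (the points of the set are the vectors satisfying it, up to ∼)
  -- cap: no three distinct points collinear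
  IsCap : (V → Set) → Set
  IsCap S = ∀ u v w → S u → S v → S w →
    ¬ (u ∼ v) → ¬ (u ∼ w) → ¬ (v ∼ w) → ¬ Dependent u v w

  IsCompleteCap : (V → Set) → Set
  IsCompleteCap S = IsCap S ×
    (∀ w → w ≢ zeroV → ¬ (∃[ s ] (S s × s ∼ w)) →
       ¬ IsCap (λ v → S v ⊎ w ∼ v))

  HasPoints : (V → Set) → ℕ → Set
  HasPoints S k = ∃[ reps ]
    (length reps ≡ k × All S reps × AllPairs (λ u v → ¬ (u ∼ v)) reps ×
     (∀ v → S v → Any (λ u → u ∼ v) reps))

  𝒱 : Carrier → V → Set
  𝒱 ω v = ∃[ x ] (x ≢ 0# × ((x ^ 2) , (ω * (x ^ suc q))) ∼ v)

  AlphaOK : Carrier → Set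
  AlphaOK α = (q ℕ.% 2 ≡ 1 → α ≡ - 1#) ×
              (q ℕ.% 2 ≡ 0 → InK α × α ≢ 0# × α ≢ 1#)

{-# OPTIONS --safe #-}

-- Let K be the field of q elements in F, let σ x = x^q, m = 2n + 1, θ = (q^m − 1)/(q − 1) = |F*/K*|.
-- As θ is odd, every element of F is c x² with c ∈ K, and g(c x²) = c x^{q+1} is a well-defined multiplicative
-- K-homogeneous map, namely the power map with exponent 1 + (q − 1)(θ + 1)/2. The points of 𝒱_ω are the
-- P(A, ω g(A)), and everything follows from the injectivity of Φ(A, B) = (A + B, g(A) + α g(B)) on F × F:
-- Φ is then bijective, so every point lies on 𝒱₁ ∪ 𝒱_α or on a line joining 𝒱₁ and 𝒱_α, and no
-- three points of which exactly two are on the same 𝒱_ω are collinear. For three points of one 𝒱_ω,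
-- A + B + C = 0 = g(A) + g(B) + g(C) and g(X)² = X σX give (A σB − B σA)² = 0, so B/A ∈ K.
--
-- By multiplicativity, a failure of injectivity normalises to g(a) − g(a − 1) = α (g(b) − g(b − 1)).
-- For even q, squaring makes this linear in a, b, σa, σb.
-- For odd q, a = c₁x² and a − 1 = c₂y² with c₁, c₂ ∈ K; the element p = c₁ x + √(c₁c₂) y has norm c₁, and, with
-- σ fixing the root, T = p^σ / p equals h + √(c₁c₂) δ for h = g(a) − g(a − 1). The product of the m Frobenius
-- images of T is p^{σ^m} / p = 1. The elements b and b − 1 give in the same way a T′ with first component −h whose
-- product is also 1. But, after rescaling the root by an element of K, T′ is minus the conjugate of T, so its
-- product is (−1)^m = −1.

module Submission where

open import Defs
open import Level using (0ℓ)
open import Data.Nat as ℕ using (ℕ; zero; suc)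
import Data.Nat.Properties as ℕ
open import Data.Nat.Combinatorics using (_C_; nCk≡n!/k![n-k]!; k![n∸k]!∣n!; nCn≡1)
open import Data.Nat.Divisibility using (_∣_; divides; ∣⇒≤; ∣1⇒≡1; m∣m*n)
open import Data.Nat.DivMod using (m/n*n≡m; m≡m%n+[m/n]*n; m%n<n)
open import Data.Nat.Primality using (Prime; euclidsLemma; prime⇒nonTrivial; prime⇒nonZero)
open import Data.Nat.Solver using (module +-*-Solver)
open import Data.Integer as ℤ using (ℤ; +_; -[1+_])
import Data.Integer.Properties as ℤ
open import Data.Fin as Fin using (Fin; fromℕ; inject₁; punchOut)
import Data.Fin.Properties as Fin
open import Data.Empty using (⊥)
open import Data.Maybe using (Maybe; just; nothing)
open import Data.Product using (∃-syntax; _×_; _,_; proj₁; proj₂)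
open import Data.Product.Function.NonDependent.Propositional using (_×-↔_)
open import Data.Product.Properties using (,-injective)
open import Data.Sum using (_⊎_; inj₁; inj₂; [_,_]′)
open import Data.Vec using (Vec; []; _∷_; replicate)
open import Data.List using (List; []; _∷_; _++_; length; map; foldr; filter; tabulate; deduplicate)
import Data.List.Properties as List
open import Data.List.Membership.Propositional using (_∈_)
open import Data.List.Membership.Propositional.Properties using (∈-map⁺; ∈-map⁻; ∈-tabulate⁺; ∈-filter⁺; ∈-filter⁻)
open import Data.List.Membership.Propositional.Properties.WithK using (unique∧set⇒bag)
open import Data.List.Relation.Binary.BagAndSetEquality using (∼bag⇒↭)
open import Data.List.Relation.Binary.Permutation.Propositional using (_↭_; ↭⇒↭ₛ)
open import Data.List.Relation.Binary.Permutation.Propositional.Properties using (↭-length)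
import Data.List.Relation.Binary.Permutation.Setoid.Properties as Permutationₛ
open import Data.List.Relation.Unary.All as All using (All; []; _∷_)
import Data.List.Relation.Unary.All.Properties as All
open import Data.List.Relation.Unary.AllPairs as AllPairs using (AllPairs; []; _∷_)
import Data.List.Relation.Unary.AllPairs.Properties as AllPairs
open import Data.List.Relation.Unary.Any as Any using (Any; here; there)
import Data.List.Relation.Unary.Any.Properties as Any
open import Data.List.Relation.Unary.Unique.Propositional using (Unique)
import Data.List.Relation.Unary.Unique.Propositional.Properties as Unique
import Data.List.Relation.Unary.Unique.DecSetoid.Properties as UniqueDecSetoid
open import Function.Base using (_∘_)
open import Function.Bundles using (Inverse; _↔_; mk⇔)
open import Function.Construct.Composition using (_↔-∘_)
open import Function.Construct.Symmetry using (↔-sym)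
open import Function.Definitions using (Injective)
open import Relation.Binary.PropositionalEquality
open import Relation.Binary.PropositionalEquality.Properties using (decSetoid)
import Relation.Binary.Construct.On as On
open import Relation.Nullary using (¬_; Dec; yes; no; contradiction)
open import Relation.Nullary.Decidable using (¬?)
open import Relation.Unary using (Decidable)
open import Algebra.Bundles using (CommutativeRing; CommutativeMonoid)
import Algebra.Properties.Monoid.Mult as Mult
open import Algebra.Solver.Ring.AlmostCommutativeRing using (_-Raw-AlmostCommutative⟶_; fromCommutativeRing)

-- Polynomial identities in a commutative ring with integer coefficients.

module ℤ-Coefficients {c ℓ} (R : CommutativeRing c ℓ) where
  open CommutativeRing R renaming (refl to ≈-refl; sym to ≈-sym; trans to ≈-trans; setoid to ≈-setoid)
  open import Algebra.Properties.Ring ring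
  open import Algebra.Properties.AbelianGroup +-abelianGroup using (⁻¹-∙-comm)
  open import Algebra.Properties.Semiring.Mult.TCOptimised semiring renaming (_×_ to _⊠_)
  open import Relation.Binary.Reasoning.Setoid ≈-setoid

  -- With the optimised multiple, `⟦ + 1 ⟧` and `⟦ + 2 ⟧` compute to `1#` and `1# + 1#`, without a
  -- trailing `0#`, so that solver constants match such sums by `refl`.
  ⟦_⟧ : ℤ → Carrier
  ⟦ + n ⟧      = n ⊠ 1#
  ⟦ -[1+ n ] ⟧ = - (suc n ⊠ 1#)

  ⊖-homo : ∀ m n → ⟦ m ℤ.⊖ n ⟧ ≈ m ⊠ 1# - n ⊠ 1#
  ⊖-homo m zero = ≈-sym (≈-trans (+-congˡ -0#≈0#) (+-identityʳ _))
  ⊖-homo zero (suc n) = ≈-sym (+-identityˡ _)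
  ⊖-homo (suc m) (suc n) = begin
    ⟦ suc m ℤ.⊖ suc n ⟧                   ≡⟨ cong ⟦_⟧ (ℤ.[1+m]⊖[1+n]≡m⊖n m n) ⟩
    ⟦ m ℤ.⊖ n ⟧                           ≈⟨ ⊖-homo m n ⟩
    a - b                                 ≈⟨ +-congʳ (+-identityˡ a) ⟨
    0# + a - b                            ≈⟨ +-congʳ (+-congʳ (-‿inverseʳ 1#)) ⟨
    (1# - 1# + a) - b                     ≈⟨ +-congʳ (+-assoc _ _ _) ⟩
    (1# + (- 1# + a)) - b                 ≈⟨ +-congʳ (+-congˡ (+-comm _ _)) ⟩
    (1# + (a - 1#)) - b                   ≈⟨ +-congʳ (+-assoc _ _ _) ⟨
    (1# + a - 1#) - b                     ≈⟨ +-assoc _ _ _ ⟩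
    (1# + a) + (- 1# - b)                 ≈⟨ +-congˡ (⁻¹-∙-comm 1# b) ⟩
    (1# + a) - (1# + b)                   ≈⟨ +-cong (1+× m 1#) (-‿cong (1+× n 1#)) ⟨
    suc m ⊠ 1# - suc n ⊠ 1#               ∎
    where a = m ⊠ 1#
          b = n ⊠ 1#

  -‿homo : ∀ i → ⟦ ℤ.- i ⟧ ≈ - ⟦ i ⟧
  -‿homo (+ zero)    = ≈-sym -0#≈0#
  -‿homo (+ suc n)   = ≈-refl
  -‿homo (-[1+ n ])  = ≈-sym (-‿involutive _)

  +-homo : ∀ i j → ⟦ i ℤ.+ j ⟧ ≈ ⟦ i ⟧ + ⟦ j ⟧
  +-homo (+ m)    (+ n)    = ×-homo-+ 1# m n
  +-homo (+ m)    -[1+ n ] = ⊖-homo m (suc n)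
  +-homo -[1+ m ] (+ n)    = ≈-trans (⊖-homo n (suc m)) (+-comm _ _)
  +-homo -[1+ m ] -[1+ n ] = begin
    - (suc (suc (m ℕ.+ n)) ⊠ 1#)     ≡⟨ cong (λ k → - (suc k ⊠ 1#)) (ℕ.+-suc m n) ⟨
    - ((suc m ℕ.+ suc n) ⊠ 1#)       ≈⟨ -‿cong (×-homo-+ 1# (suc m) (suc n)) ⟩
    - (suc m ⊠ 1# + suc n ⊠ 1#)      ≈⟨ ⁻¹-∙-comm _ _ ⟨
    - (suc m ⊠ 1#) - suc n ⊠ 1#      ∎

  *-homo⁺ : ∀ m j → ⟦ + m ℤ.* j ⟧ ≈ ⟦ + m ⟧ * ⟦ j ⟧
  *-homo⁺ m (+ n) = ≈-trans (reflexive (cong ⟦_⟧ (sym (ℤ.pos-* m n)))) (×1-homo-* m n)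
  *-homo⁺ m -[1+ n ] = begin
    ⟦ + m ℤ.* ℤ.- + suc n ⟧       ≡⟨ cong ⟦_⟧ (ℤ.neg-distribʳ-* (+ m) (+ suc n)) ⟨
    ⟦ ℤ.- (+ m ℤ.* + suc n) ⟧     ≈⟨ -‿homo (+ m ℤ.* + suc n) ⟩
    - ⟦ + m ℤ.* + suc n ⟧         ≈⟨ -‿cong (*-homo⁺ m (+ suc n)) ⟩
    - (⟦ + m ⟧ * ⟦ + suc n ⟧)     ≈⟨ -‿distribʳ-* _ _ ⟩
    ⟦ + m ⟧ * - ⟦ + suc n ⟧       ∎

  *-homo : ∀ i j → ⟦ i ℤ.* j ⟧ ≈ ⟦ i ⟧ * ⟦ j ⟧
  *-homo (+ m)    j = *-homo⁺ m j
  *-homo -[1+ m ] j = begin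
    ⟦ ℤ.- + suc m ℤ.* j ⟧       ≡⟨ cong ⟦_⟧ (ℤ.neg-distribˡ-* (+ suc m) j) ⟨
    ⟦ ℤ.- (+ suc m ℤ.* j) ⟧     ≈⟨ -‿homo (+ suc m ℤ.* j) ⟩
    - ⟦ + suc m ℤ.* j ⟧         ≈⟨ -‿cong (*-homo⁺ (suc m) j) ⟩
    - (⟦ + suc m ⟧ * ⟦ j ⟧)     ≈⟨ -‿distribˡ-* _ _ ⟩
    - ⟦ + suc m ⟧ * ⟦ j ⟧       ∎

  morphism : ℤ.+-*-rawRing -Raw-AlmostCommutative⟶ fromCommutativeRing R
  morphism = record
    { ⟦_⟧ = ⟦_⟧ ; +-homo = +-homo ; *-homo = *-homo ; -‿homo = -‿homo
    ; 0-homo = ≈-refl ; 1-homo = ≈-refl }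

  -- Distinct integers may have equal images in positive characteristic, so a negative answer
  -- decides nothing.
  _≟ᶜ_ : ∀ i j → Maybe (⟦ i ⟧ ≈ ⟦ j ⟧)
  i ≟ᶜ j with i ℤ.≟ j
  ... | yes i≡j = just (reflexive (cong ⟦_⟧ i≡j))
  ... | no  _   = nothing

  open import Algebra.Solver.Ring ℤ.+-*-rawRing (fromCommutativeRing R) morphism _≟ᶜ_ public
    using (solve; _:=_; con; _:+_; _:*_; _:-_; :-_)

-- Binomial coefficients modulo a prime.

prime∤! : ∀ {p} → Prime p → ∀ {j} → j ℕ.< p → ¬ p ∣ j ℕ.!
prime∤! {p} pr {zero} _ p∣1 = contradiction (∣1⇒≡1 p∣1) (ℕ.nonTrivial⇒≢1 ⦃ prime⇒nonTrivial pr ⦄)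
prime∤! pr {suc j} j<p p∣ with euclidsLemma (suc j) (j ℕ.!) pr p∣
... | inj₁ p∣j = contradiction (∣⇒≤ p∣j) (ℕ.<⇒≱ j<p)
... | inj₂ p∣j! = prime∤! pr (ℕ.<-trans (ℕ.n<1+n j) j<p) p∣j!

-- The prime divides `p! = (p C k) k! (p − k)!`, but neither of the two factorials on the right,
-- since all their factors are below `p`.
prime∣C : ∀ {p} → Prime p → ∀ {k} → 0 ℕ.< k → k ℕ.< p → p ∣ p C k
prime∣C {p} pr {k} 0<k k<p
  with euclidsLemma (p C k) (k ℕ.! ℕ.* (p ℕ.∸ k) ℕ.!) pr (subst (p ∣_) (sym C*k!) (p∣p! p 0<p))
  where
  instance _ = k ℕ.!* (p ℕ.∸ k) !≢0
  0<p : 0 ℕ.< p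
  0<p = ℕ.<-trans 0<k k<p
  p∣p! : ∀ n → 0 ℕ.< n → n ∣ n ℕ.!
  p∣p! (suc n) _ = m∣m*n (n ℕ.!)
  C*k! : (p C k) ℕ.* (k ℕ.! ℕ.* (p ℕ.∸ k) ℕ.!) ≡ p ℕ.!
  C*k! = trans (cong (ℕ._* (k ℕ.! ℕ.* (p ℕ.∸ k) ℕ.!)) (nCk≡n!/k![n-k]! (ℕ.<⇒≤ k<p)))
               (m/n*n≡m (k![n∸k]!∣n! (ℕ.<⇒≤ k<p)))
... | inj₁ p∣C = p∣C
... | inj₂ p∣! with euclidsLemma (k ℕ.!) ((p ℕ.∸ k) ℕ.!) pr p∣!
...   | inj₁ p∣k! = contradiction p∣k! (prime∤! pr k<p)
...   | inj₂ p∣[p-k]! = contradiction p∣[p-k]! (prime∤! pr (ℕ.∸-monoʳ-< 0<k (ℕ.<⇒≤ k<p)))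

-- Permutations of lists and products over them.

module _ {a} {A : Set a} where

  unique-set⇒↭ : {xs ys : List A} → Unique xs → Unique ys →
    (∀ {x} → x ∈ xs → x ∈ ys) → (∀ {x} → x ∈ ys → x ∈ xs) → xs ↭ ys
  unique-set⇒↭ uxs uys to from = ∼bag⇒↭ (unique∧set⇒bag uxs uys (mk⇔ to from))

module _ (M : CommutativeMonoid 0ℓ 0ℓ) where
  open CommutativeMonoid M renaming (refl to ≈-refl; sym to ≈-sym; trans to ≈-trans; setoid to ≈-setoid)
  open Mult monoid renaming (_×_ to _⊠_)
  open import Relation.Binary.Reasoning.Setoid ≈-setoid
  open import Algebra.Properties.CommutativeSemigroup commutativeSemigroup using (interchange)

  -- When `a ∙_` permutes the list, the two products agree and the factor `length xs ⊠ a` must be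
  -- trivial. This yields `fermat` for multiplication and `card⊠1≡0` for addition.
  foldr-map-∙ : ∀ a xs → foldr _∙_ ε (map (a ∙_) xs) ≈ (length xs ⊠ a) ∙ foldr _∙_ ε xs
  foldr-map-∙ a []       = ≈-sym (identityˡ ε)
  foldr-map-∙ a (x ∷ xs) = ≈-trans (∙-congˡ (foldr-map-∙ a xs)) (interchange a x _ _)

-- Field arithmetic, powers and roots of monic polynomials.

module FieldProperties (F : FiniteField) where
  open FiniteField F

  commutativeRing : CommutativeRing 0ℓ 0ℓ
  commutativeRing = record { isCommutativeRing = isCommutativeRing }

  open CommutativeRing commutativeRing public
    using (+-assoc; +-comm; +-identityˡ; +-identityʳ; -‿inverseˡ; -‿inverseʳ;
           *-assoc; *-comm; *-identityˡ; *-identityʳ; zeroˡ; zeroʳ;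
           _-_; semiring; commutativeSemiring; *-commutativeMonoid; +-commutativeMonoid)
  open ℤ-Coefficients commutativeRing public using (solve; _:=_; con; _:+_; _:*_; _:-_; :-_)

  x-y≡0⇒x≡y : ∀ {x y} → x - y ≡ 0# → x ≡ y
  x-y≡0⇒x≡y {x} {y} eq = trans (solve 2 (λ x y → x := (x :- y) :+ y) refl x y)
                               (trans (cong (_+ y) eq) (+-identityˡ y))

  x≡y⇒x-y≡0 : ∀ {x y} → x ≡ y → x - y ≡ 0#
  x≡y⇒x-y≡0 {x} refl = -‿inverseʳ x

  +-cancelʳ : ∀ {x y} z → x + z ≡ y + z → x ≡ y
  +-cancelʳ {x} {y} z eq = x-y≡0⇒x≡y (trans (solve 3 (λ x y z → x :- y := (x :+ z) :- (y :+ z)) refl x y z) (x≡y⇒x-y≡0 eq))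

  infix 25 _⁻¹[_]
  _⁻¹[_] : ∀ x → x ≢ 0# → Carrier
  x ⁻¹[ x≢0 ] = proj₁ (inverse x x≢0)

  *-inverseʳ : ∀ {x} (x≢0 : x ≢ 0#) → x * x ⁻¹[ x≢0 ] ≡ 1#
  *-inverseʳ {x} x≢0 = proj₂ (inverse x x≢0)

  *-cancelˡ : ∀ {x y z} → x ≢ 0# → x * y ≡ x * z → y ≡ z
  *-cancelˡ {x} {y} {z} x≢0 eq = trans (lem y) (trans (cong (x ⁻¹[ x≢0 ] *_) eq) (sym (lem z)))
    where
    lem : ∀ w → w ≡ x ⁻¹[ x≢0 ] * (x * w)
    lem w = sym (trans (solve 3 (λ i x w → i :* (x :* w) := (x :* i) :* w) refl _ x w)
              (trans (cong (_* w) (*-inverseʳ x≢0)) (*-identityˡ w)))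

  *-≢0 : ∀ {x y} → x ≢ 0# → y ≢ 0# → x * y ≢ 0#
  *-≢0 {x} x≢0 y≢0 eq = y≢0 (*-cancelˡ x≢0 (trans eq (sym (zeroʳ x))))

  ⁻¹-≢0 : ∀ {x} (x≢0 : x ≢ 0#) → x ⁻¹[ x≢0 ] ≢ 0#
  ⁻¹-≢0 {x} x≢0 eq = 0≢1 (trans (sym (zeroʳ x)) (trans (cong (x *_) (sym eq)) (*-inverseʳ x≢0)))

  x*y≡0⇒y≡0 : ∀ {x y} → x ≢ 0# → x * y ≡ 0# → y ≡ 0#
  x*y≡0⇒y≡0 {x} x≢0 eq = *-cancelˡ x≢0 (trans eq (sym (zeroʳ x)))

  x²≡0⇒x≡0 : ∀ {x} → x * x ≡ 0# → x ≡ 0#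
  x²≡0⇒x≡0 {x} eq with x ≟ 0#
  ... | yes x≡0 = x≡0
  ... | no x≢0 = x*y≡0⇒y≡0 x≢0 eq

  x²≡y²⇒x≡±y : ∀ {x y} → x * x ≡ y * y → x ≡ y ⊎ x ≡ - y
  x²≡y²⇒x≡±y {x} {y} eq with (x - y) ≟ 0#
  ... | yes x-y≡0 = inj₁ (x-y≡0⇒x≡y x-y≡0)
  ... | no  x-y≢0 = inj₂ (x-y≡0⇒x≡y (trans (solve 2 (λ x y → x :- :- y := x :+ y) refl x y)
      (x*y≡0⇒y≡0 x-y≢0 (trans (solve 2 (λ x y → (x :- y) :* (x :+ y) := x :* x :- y :* y) refl x y) (x≡y⇒x-y≡0 eq)))))

  neg-≢0 : ∀ {x} → x ≢ 0# → - x ≢ 0#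
  neg-≢0 {x} x≢0 -x≡0 = x≢0 (trans (sym (+-identityʳ x)) (trans (cong (_+_ x) (sym -x≡0)) (-‿inverseʳ x)))

  open import Algebra.Properties.Semiring.Exp semiring using () renaming (_^_ to _^ˢ_)
  import Algebra.Properties.Semiring.Exp semiring as Exp
  import Algebra.Properties.CommutativeSemiring.Exp commutativeSemiring as CExp

  ^≡^ˢ : ∀ x k → x ^ k ≡ x ^ˢ k
  ^≡^ˢ x zero    = refl
  ^≡^ˢ x (suc k) = cong (x *_) (^≡^ˢ x k)

  ^-homo-* : ∀ x m n → x ^ (m ℕ.+ n) ≡ x ^ m * x ^ n
  ^-homo-* x m n rewrite ^≡^ˢ x (m ℕ.+ n) | ^≡^ˢ x m | ^≡^ˢ x n = Exp.^-homo-* x m n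

  ^-assocʳ : ∀ x m n → (x ^ m) ^ n ≡ x ^ (m ℕ.* n)
  ^-assocʳ x m n rewrite ^≡^ˢ x m | ^≡^ˢ (x ^ˢ m) n | ^≡^ˢ x (m ℕ.* n) = Exp.^-assocʳ x m n

  ^-distrib-* : ∀ x y n → (x * y) ^ n ≡ x ^ n * y ^ n
  ^-distrib-* x y n rewrite ^≡^ˢ (x * y) n | ^≡^ˢ x n | ^≡^ˢ y n = CExp.^-distrib-* x y n

  1^ : ∀ n → 1# ^ n ≡ 1#
  1^ zero    = refl
  1^ (suc n) = trans (*-identityˡ _) (1^ n)

  ^-≢0 : ∀ {x} n → x ≢ 0# → x ^ n ≢ 0#
  ^-≢0 zero    x≢0 eq = 0≢1 (sym eq)
  ^-≢0 (suc n) x≢0 = *-≢0 x≢0 (^-≢0 n x≢0)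

  -- Monic polynomials of degree d, given by their lower coefficients in increasing degree.
  eval : ∀ {d} → Vec Carrier d → Carrier → Carrier
  eval []      x = 1#
  eval (a ∷ p) x = a + x * eval p x

  -- Synthetic division by `x − r`: the coefficients are the Horner values at `r` of the successive
  -- tails.
  quotient : ∀ {d} → Vec Carrier (suc d) → Carrier → Vec Carrier d
  quotient (a ∷ [])        r = []
  quotient (a ∷ p@(_ ∷ _)) r = eval p r ∷ quotient p r

  eval-quotient : ∀ {d} (p : Vec Carrier (suc d)) r x →
    eval p x ≡ eval p r + (x - r) * eval (quotient p r) x
  eval-quotient (a ∷ []) r x =
    solve 3 (λ a r x → a :+ x :* con (+ 1) := (a :+ r :* con (+ 1)) :+ (x :- r) :* con (+ 1)) refl a r x
  eval-quotient (a ∷ p@(_ ∷ _)) r x = trans (cong (λ e → a + x * e) (eval-quotient p r x))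
    (solve 5 (λ a r x e f → a :+ x :* (e :+ (x :- r) :* f) := (a :+ r :* e) :+ (x :- r) :* (e :+ x :* f)) refl
      a r x (eval p r) (eval (quotient p r) x))

  #roots≤degree : ∀ {d} (p : Vec Carrier d) {xs} → Unique xs → All (λ x → eval p x ≡ 0#) xs → length xs ℕ.≤ d
  #roots≤degree p [] [] = ℕ.z≤n
  #roots≤degree [] (_ ∷ _) (1≡0 ∷ _) = contradiction (sym 1≡0) 0≢1
  #roots≤degree p@(_ ∷ _) {r ∷ xs} (r∉xs ∷ uxs) (pr≡0 ∷ roots) =
    ℕ.s≤s (#roots≤degree (quotient p r) uxs (All.zipWith root (r∉xs , roots)))
    where
    root : ∀ {x} → r ≢ x × eval p x ≡ 0# → eval (quotient p r) x ≡ 0#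
    root {x} (r≢x , px≡0) = x*y≡0⇒y≡0 (r≢x ∘ sym ∘ x-y≡0⇒x≡y)
      (trans (sym (trans (cong (_+ (x - r) * eval (quotient p r) x) pr≡0) (+-identityˡ _))) (trans (sym (eval-quotient p r x)) px≡0))

  -- Serves twice in counting points: it bounds the fibres of `x ↦ x ^ r` on `F*` and the number of
  -- values of that map.
  #x^d≡c≤d : ∀ d c {xs} → Unique xs → All (λ x → x ^ suc d ≡ c) xs → length xs ℕ.≤ suc d
  #x^d≡c≤d d c uxs eqs = #roots≤degree (- c ∷ replicate d 0#) uxs (All.map root eqs)
    where
    eval-0s : ∀ d x → eval (replicate d 0#) x ≡ x ^ d
    eval-0s zero    x = refl
    eval-0s (suc d) x = trans (+-identityˡ _) (cong (x *_) (eval-0s d x))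
    root : ∀ {x} → x ^ suc d ≡ c → eval (- c ∷ replicate d 0#) x ≡ 0#
    root {x} refl = trans (cong (λ e → - c + x * e) (eval-0s d x)) (-‿inverseˡ c)

  -- Enumeration of the field and its two consequences for powers and multiples.

  elements : List Carrier
  elements = tabulate (Inverse.from enum)

  elements-unique : Unique elements
  elements-unique = Unique.tabulate⁺ from-injective
    where
    from-injective : Injective _≡_ _≡_ (Inverse.from enum)
    from-injective {i} {j} eq = trans (sym (Inverse.strictlyInverseˡ enum i))
      (trans (cong (Inverse.to enum) eq) (Inverse.strictlyInverseˡ enum j))

  ∈-elements : ∀ x → x ∈ elements
  ∈-elements x = subst (_∈ elements) (Inverse.strictlyInverseʳ enum x) (∈-tabulate⁺ (Inverse.to enum x))

  length-elements : length elements ≡ card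
  length-elements = List.length-tabulate (Inverse.from enum)

  nonzeros : List Carrier
  nonzeros = filter (λ x → ¬? (x ≟ 0#)) elements

  nonzeros-unique : Unique nonzeros
  nonzeros-unique = Unique.filter⁺ _ elements-unique

  ∈-nonzeros⁺ : ∀ {x} → x ≢ 0# → x ∈ nonzeros
  ∈-nonzeros⁺ {x} x≢0 = ∈-filter⁺ _ (∈-elements x) x≢0

  ∈-nonzeros⁻ : ∀ {x} → x ∈ nonzeros → x ≢ 0#
  ∈-nonzeros⁻ x∈ = proj₂ (∈-filter⁻ _ {xs = elements} x∈)

  length-nonzeros : suc (length nonzeros) ≡ card
  length-nonzeros = trans (↭-length (unique-set⇒↭ (All.tabulate (λ x∈ 0≡x → ∈-nonzeros⁻ x∈ (sym 0≡x)) ∷ nonzeros-unique)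
      elements-unique (λ _ → ∈-elements _) from)) length-elements
    where
    from : ∀ {x} → x ∈ elements → x ∈ 0# ∷ nonzeros
    from {x} _ with x ≟ 0#
    ... | yes x≡0 = here x≡0
    ... | no  x≢0 = there (∈-nonzeros⁺ x≢0)

  open import Algebra.Properties.Semiring.Mult semiring public using (×1-homo-*; ×-assoc-*) renaming (_×_ to _⊠_)

  -- Multiplication by `x` permutes the nonzero elements, whose product is nonzero and can be
  -- cancelled.
  fermat : ∀ {x} → x ≢ 0# → x ^ length nonzeros ≡ 1#
  fermat {x} x≢0 = *-cancelˡ (prod≢0 nonzeros (All.tabulate ∈-nonzeros⁻)) (begin
    prod nonzeros * x ^ length nonzeros          ≡⟨ *-comm _ _ ⟩
    x ^ length nonzeros * prod nonzeros          ≡⟨ cong (_* prod nonzeros) (^≡^ˢ x (length nonzeros)) ⟩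
    x ^ˢ length nonzeros * prod nonzeros         ≡⟨ foldr-map-∙ *-commutativeMonoid x nonzeros ⟨
    prod (map (x *_) nonzeros)                   ≡⟨ Permutationₛ.foldr-commMonoid (setoid Carrier)
                                                      (CommutativeMonoid.isCommutativeMonoid *-commutativeMonoid)
                                                      (↭⇒↭ₛ (unique-set⇒↭ (Unique.map⁺ (*-cancelˡ x≢0) nonzeros-unique) nonzeros-unique to from)) ⟩
    prod nonzeros                                ≡⟨ *-identityʳ _ ⟨
    prod nonzeros * 1#                           ∎)
    where
    open ≡-Reasoning
    prod : List Carrier → Carrier
    prod = foldr _*_ 1#
    prod≢0 : ∀ xs → All (_≢ 0#) xs → prod xs ≢ 0#
    prod≢0 []       []           = 0≢1 ∘ sym
    prod≢0 (x ∷ xs) (x≢0 ∷ xs≢0) = *-≢0 x≢0 (prod≢0 xs xs≢0)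
    to : ∀ {y} → y ∈ map (x *_) nonzeros → y ∈ nonzeros
    to y∈ with ∈-map⁻ (x *_) y∈
    ... | _ , z∈ , refl = ∈-nonzeros⁺ (*-≢0 x≢0 (∈-nonzeros⁻ z∈))
    from : ∀ {y} → y ∈ nonzeros → y ∈ map (x *_) nonzeros
    from {y} y∈ = subst (_∈ map (x *_) nonzeros)
      (trans (sym (*-assoc x _ y)) (trans (cong (_* y) (*-inverseʳ x≢0)) (*-identityˡ y)))
      (∈-map⁺ (x *_) (∈-nonzeros⁺ (*-≢0 (⁻¹-≢0 x≢0) (∈-nonzeros⁻ y∈))))

  x^card≡x : ∀ x → x ^ card ≡ x
  x^card≡x x rewrite sym length-nonzeros with x ≟ 0#
  ... | yes refl = zeroˡ _
  ... | no x≢0 = trans (cong (x *_) (fermat x≢0)) (*-identityʳ x)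

  -- The additive analogue of `fermat`: translation by `1#` permutes the field, so the sum of all
  -- elements can be cancelled.
  card⊠1≡0 : card ⊠ 1# ≡ 0#
  card⊠1≡0 = +-cancelʳ (total elements) (begin
    card ⊠ 1# + total elements              ≡⟨ cong (λ n → n ⊠ 1# + total elements) length-elements ⟨
    length elements ⊠ 1# + total elements   ≡⟨ foldr-map-∙ +-commutativeMonoid 1# elements ⟨
    total (map (_+_ 1#) elements)           ≡⟨ Permutationₛ.foldr-commMonoid (setoid Carrier)
                                                (CommutativeMonoid.isCommutativeMonoid +-commutativeMonoid)
                                                (↭⇒↭ₛ (unique-set⇒↭ (Unique.map⁺ 1+-injective elements-unique) elements-unique
                                                  (λ _ → ∈-elements _) from)) ⟩
    total elements                          ≡⟨ +-identityˡ _ ⟨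
    0# + total elements                     ∎)
    where
    open ≡-Reasoning
    total : List Carrier → Carrier
    total = foldr _+_ 0#
    1+-injective : ∀ {x y} → 1# + x ≡ 1# + y → x ≡ y
    1+-injective eq = +-cancelʳ 1# (trans (+-comm _ 1#) (trans eq (+-comm 1# _)))
    from : ∀ {x} → x ∈ elements → x ∈ map (_+_ 1#) elements
    from {x} _ = subst (_∈ map (_+_ 1#) elements) (solve 1 (λ x → con (+ 1) :+ (x :- con (+ 1)) := x) refl x)
      (∈-map⁺ (_+_ 1#) (∈-elements (x - 1#)))

  -- Characteristic and the Frobenius endomorphism.

  module Characteristic {p} (pr : Prime p) {j} (card≡p^j : card ≡ p ℕ.^ j) where

    -- Otherwise its power `(p ⊠ 1#) ^ j = card ⊠ 1#` would be nonzero too.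
    p⊠1≡0 : p ⊠ 1# ≡ 0#
    p⊠1≡0 with (p ⊠ 1#) ≟ 0#
    ... | yes eq  = eq
    ... | no  p≢0 = contradiction (trans (sym (homo j)) (trans (cong (_⊠ 1#) (sym card≡p^j)) card⊠1≡0)) (^-≢0 j p≢0)
      where
      homo : ∀ j → (p ℕ.^ j) ⊠ 1# ≡ (p ⊠ 1#) ^ j
      homo zero    = +-identityʳ 1#
      homo (suc j) = trans (×1-homo-* p (p ℕ.^ j)) (cong ((p ⊠ 1#) *_) (homo j))

    p∣n⇒n⊠≡0 : ∀ {n} → p ∣ n → ∀ x → n ⊠ x ≡ 0#
    p∣n⇒n⊠≡0 (divides k refl) x = begin
      (k ℕ.* p) ⊠ x                 ≡⟨ cong ((k ℕ.* p) ⊠_) (*-identityˡ x) ⟨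
      (k ℕ.* p) ⊠ (1# * x)          ≡⟨ ×-assoc-* (k ℕ.* p) 1# x ⟨
      (k ℕ.* p) ⊠ 1# * x            ≡⟨ cong (_* x) (×1-homo-* k p) ⟩
      k ⊠ 1# * (p ⊠ 1#) * x         ≡⟨ cong (λ z → k ⊠ 1# * z * x) p⊠1≡0 ⟩
      k ⊠ 1# * 0# * x               ≡⟨ solve 2 (λ k x → k :* con (+ 0) :* x := con (+ 0)) refl (k ⊠ 1#) x ⟩
      0#                            ∎
      where open ≡-Reasoning

    open import Algebra.Properties.CommutativeSemiring.Binomial commutativeSemiring using (theorem; binomialTerm)
    open import Algebra.Properties.Monoid.Sum (CommutativeMonoid.monoid +-commutativeMonoid)
      using (sum; sum-init-last; sum-cong-≋; sum-replicate-zero)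

    frobenius-+ : ∀ x y → (x + y) ^ p ≡ x ^ p + y ^ p
    frobenius-+ x y = trans (^≡^ˢ (x + y) p) (trans (theorem p x y) (trans (expand p refl)
        (sym (cong₂ _+_ (^≡^ˢ x p) (^≡^ˢ y p)))))
      where
      open ≡-Reasoning
      -- The exponent is generalised so that it can be matched as a successor and the sum can be
      -- split into first, middle and last terms. The middle coefficients are divisible by `p`.
      expand : ∀ n → p ≡ n → sum (binomialTerm x y n) ≡ x ^ˢ n + y ^ˢ n
      expand zero refl = contradiction refl (ℕ.≢-nonZero⁻¹ p ⦃ prime⇒nonZero pr ⦄)
      expand (suc n) refl = begin
        t Fin.zero + sum (t ∘ Fin.suc)                                 ≡⟨ cong₂ _+_ t₀ (sum-init-last (t ∘ Fin.suc)) ⟩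
        y ^ˢ p + (sum (λ i → t (Fin.suc (inject₁ i))) + t (fromℕ p))   ≡⟨ cong (λ z → y ^ˢ p + (z + t (fromℕ p))) middle ⟩
        y ^ˢ p + (0# + t (fromℕ p))                                    ≡⟨ cong (λ z → y ^ˢ p + (0# + z)) tₚ ⟩
        y ^ˢ p + (0# + x ^ˢ p)                                         ≡⟨ solve 2 (λ x y → y :+ (con (+ 0) :+ x) := x :+ y) refl _ _ ⟩
        x ^ˢ p + y ^ˢ p                                                ∎
        where
        t = binomialTerm x y (suc n)
        t₀ : t Fin.zero ≡ y ^ˢ p
        t₀ = trans (+-identityʳ _) (*-identityˡ _)
        middle : sum (λ (i : Fin n) → t (Fin.suc (inject₁ i))) ≡ 0#
        middle = trans (sum-cong-≋ (λ i → p∣n⇒n⊠≡0 (prime∣C pr (ℕ.s≤s ℕ.z≤n)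
          (ℕ.s≤s (subst (ℕ._< n) (sym (Fin.toℕ-inject₁ i)) (Fin.toℕ<n i)))) _)) (sum-replicate-zero n)
        tₚ : t (fromℕ p) ≡ x ^ˢ p
        tₚ rewrite Fin.toℕ-fromℕ n | nCn≡1 p | ℕ.n∸n≡0 n = trans (+-identityʳ _) (*-identityʳ _)

    frobenius^-+ : ∀ k x y → (x + y) ^ (p ℕ.^ k) ≡ x ^ (p ℕ.^ k) + y ^ (p ℕ.^ k)
    frobenius^-+ zero x y = trans (*-identityʳ _) (sym (cong₂ _+_ (*-identityʳ x) (*-identityʳ y)))
    frobenius^-+ (suc k) x y = begin
      (x + y) ^ (p ℕ.* p ℕ.^ k)                     ≡⟨ ^-assocʳ (x + y) p (p ℕ.^ k) ⟨
      ((x + y) ^ p) ^ (p ℕ.^ k)                     ≡⟨ cong (_^ (p ℕ.^ k)) (frobenius-+ x y) ⟩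
      (x ^ p + y ^ p) ^ (p ℕ.^ k)                   ≡⟨ frobenius^-+ k (x ^ p) (y ^ p) ⟩
      (x ^ p) ^ (p ℕ.^ k) + (y ^ p) ^ (p ℕ.^ k)     ≡⟨ cong₂ _+_ (^-assocʳ x p _) (^-assocʳ y p _) ⟩
      x ^ (p ℕ.* p ℕ.^ k) + y ^ (p ℕ.* p ℕ.^ k)     ∎
      where open ≡-Reasoning

-- The extension F of K of odd degree: Frobenius `σ` and the map `g`.

half-exponent : ∀ r d → suc (r ℕ.* suc d) ℕ.+ suc (r ℕ.* suc d) ≡ suc (r ℕ.* suc (2 ℕ.* d)) ℕ.+ suc r
half-exponent = solve 2 (λ r d → (con 1 :+ r :* (con 1 :+ d)) :+ (con 1 :+ r :* (con 1 :+ d))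
  := (con 1 :+ r :* (con 1 :+ con 2 :* d)) :+ (con 1 :+ r)) refl
  where open +-*-Solver

PowerAdditive : FiniteField → ℕ → Set
PowerAdditive F q = ∀ x y → (x + y) ^ q ≡ x ^ q + y ^ q
  where open FiniteField F

-- Here `q = 1 + r` and `θ = 1 + 2d`; writing `q^m` as `1 + r θ` in this shape builds the oddness of
-- `θ` into the parameters.
module OddExtension (F : FiniteField) (r d n : ℕ)
  (σ-+ : PowerAdditive F (suc r))
  (card≡ : FiniteField.card F ≡ suc r ℕ.^ (2 ℕ.* n ℕ.+ 1))
  (card-1≡ : suc r ℕ.^ (2 ℕ.* n ℕ.+ 1) ≡ suc (r ℕ.* suc (2 ℕ.* d)))
  where
  open FiniteField F
  open FieldProperties F public

  q : ℕ
  q = suc r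

  open Geometry F q public using (InK)

  σ : Carrier → Carrier
  σ x = x ^ q

  σ-* : ∀ x y → σ (x * y) ≡ σ x * σ y
  σ-* x y = ^-distrib-* x y q

  σ-0 : σ 0# ≡ 0#
  σ-0 = zeroˡ _

  σ-1 : σ 1# ≡ 1#
  σ-1 = 1^ q

  σ-neg : ∀ x → σ (- x) ≡ - σ x
  σ-neg x = +-cancelʳ (σ x) (trans (sym (σ-+ (- x) x))
    (trans (trans (cong σ (-‿inverseˡ x)) σ-0) (sym (-‿inverseˡ (σ x)))))

  σ-sub : ∀ x y → σ (x - y) ≡ σ x - σ y
  σ-sub x y = trans (σ-+ x (- y)) (cong (_+_ (σ x)) (σ-neg y))

  InK-* : ∀ {x y} → InK x → InK y → InK (x * y)
  InK-* {x} {y} kx ky = trans (σ-* x y) (cong₂ _*_ kx ky)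

  InK-neg : ∀ {x} → InK x → InK (- x)
  InK-neg {x} kx = trans (σ-neg x) (cong -_ kx)

  InK-⁻¹ : ∀ {x} → InK x → (x≢0 : x ≢ 0#) → InK (x ⁻¹[ x≢0 ])
  InK-⁻¹ {x} kx x≢0 = *-cancelˡ x≢0 (begin
    x * σ i      ≡⟨ cong (_* σ i) kx ⟨
    σ x * σ i    ≡⟨ σ-* x i ⟨
    σ (x * i)    ≡⟨ cong σ (*-inverseʳ x≢0) ⟩
    σ 1#         ≡⟨ σ-1 ⟩
    1#           ≡⟨ *-inverseʳ x≢0 ⟨
    x * i        ∎)
    where open ≡-Reasoning
          i = x ⁻¹[ x≢0 ]

  σ^ : ℕ → Carrier → Carrier
  σ^ zero    x = x
  σ^ (suc i) x = σ (σ^ i x)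

  σ^≡^ : ∀ i x → σ^ i x ≡ x ^ (q ℕ.^ i)
  σ^≡^ zero x = sym (*-identityʳ x)
  σ^≡^ (suc i) x = trans (cong σ (σ^≡^ i x)) (trans (^-assocʳ x (q ℕ.^ i) q) (cong (x ^_) (ℕ.*-comm (q ℕ.^ i) q)))

  x^[q^m]≡x : ∀ x → x ^ (q ℕ.^ (2 ℕ.* n ℕ.+ 1)) ≡ x
  x^[q^m]≡x x = trans (cong (x ^_) (sym card≡)) (x^card≡x x)

  m≡ : 2 ℕ.* n ℕ.+ 1 ≡ suc (n ℕ.+ n)
  m≡ = trans (ℕ.+-comm (2 ℕ.* n) 1) (cong (λ k → suc (n ℕ.+ k)) (ℕ.+-identityʳ n))

  σ^m≡id : ∀ x → σ^ (suc (n ℕ.+ n)) x ≡ x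
  σ^m≡id x = trans (σ^≡^ (suc (n ℕ.+ n)) x) (trans (cong (λ m → x ^ (q ℕ.^ m)) (sym m≡)) (x^[q^m]≡x x))

  -- The order of `σ` divides the odd number `2n + 1`: since `σ^(2n)` fixes `x`, one more
  -- application gives `σ x = σ^(2n+1) x = x`.
  σ²-fixed⇒InK : ∀ {x} → σ (σ x) ≡ x → InK x
  σ²-fixed⇒InK {x} fix = trans (cong σ (sym (even n))) (σ^m≡id x)
    where
    even : ∀ k → σ^ (k ℕ.+ k) x ≡ x
    even zero = refl
    even (suc k) rewrite ℕ.+-suc k k = trans (cong (σ ∘ σ) (even k)) fix

  -- On nonzero elements, g is the multiplicative K-homogeneous map sending c x² to c x^{q+1}
  -- for c ∈ K; the cone over 𝒱 ω is {(A, ω g(A))}.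
  g : Carrier → Carrier
  g x = x ^ suc (r ℕ.* suc d)

  g-* : ∀ x y → g (x * y) ≡ g x * g y
  g-* x y = ^-distrib-* x y (suc (r ℕ.* suc d))

  g-0 : g 0# ≡ 0#
  g-0 = zeroˡ _

  g-≢0 : ∀ {x} → x ≢ 0# → g x ≢ 0#
  g-≢0 = ^-≢0 (suc (r ℕ.* suc d))

  -- Twice the exponent of `g` is `q^m + q`, and `x^(q^m) = x`.
  g*g : ∀ x → g x * g x ≡ x * σ x
  g*g x = begin
    g x * g x                                 ≡⟨ ^-homo-* x s s ⟨
    x ^ (s ℕ.+ s)                             ≡⟨ cong (x ^_) (half-exponent r d) ⟩
    x ^ (suc (r ℕ.* suc (2 ℕ.* d)) ℕ.+ q)     ≡⟨ ^-homo-* x (suc (r ℕ.* suc (2 ℕ.* d))) q ⟩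
    x ^ suc (r ℕ.* suc (2 ℕ.* d)) * σ x       ≡⟨ cong (λ k → x ^ k * σ x) card-1≡ ⟨
    x ^ (q ℕ.^ (2 ℕ.* n ℕ.+ 1)) * σ x         ≡⟨ cong (_* σ x) (x^[q^m]≡x x) ⟩
    x * σ x                                   ∎
    where
    open ≡-Reasoning
    s = suc (r ℕ.* suc d)

  -- The exponent of `g` is 1 modulo `r = q − 1`, and each `r` further factors `c` are absorbed by
  -- `c · c^r = c`.
  InK⇒g≡id : ∀ {c} → InK c → g c ≡ c
  InK⇒g≡id {c} kc = trans (cong (λ k → c ^ suc k) (ℕ.*-comm r (suc d))) (pow (suc d))
    where
    pow : ∀ k → c ^ suc (k ℕ.* r) ≡ c
    pow zero = *-identityʳ c
    pow (suc k) = begin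
      c * c ^ (r ℕ.+ k ℕ.* r)          ≡⟨ cong (c *_) (^-homo-* c r (k ℕ.* r)) ⟩
      c * (c ^ r * c ^ (k ℕ.* r))      ≡⟨ *-assoc c _ _ ⟨
      σ c * c ^ (k ℕ.* r)              ≡⟨ cong (_* c ^ (k ℕ.* r)) kc ⟩
      c * c ^ (k ℕ.* r)                ≡⟨ pow k ⟩
      c                                ∎
      where open ≡-Reasoning

  g-homogeneous : ∀ {c} → InK c → ∀ x → g (c * x) ≡ c * g x
  g-homogeneous {c} kc x = trans (g-* c x) (cong (_* g x) (InK⇒g≡id kc))

  g-neg : ∀ x → g (- x) ≡ - g x
  g-neg x = trans (cong g (-x≡-1*x x)) (trans (g-homogeneous (InK-neg σ-1) x) (sym (-x≡-1*x (g x))))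
    where
    -x≡-1*x : ∀ x → - x ≡ - 1# * x
    -x≡-1*x = solve 1 (λ x → :- x := (:- con (+ 1)) :* x) refl

  g[cx²] : ∀ {c} → InK c → ∀ x → g (c * (x * x)) ≡ c * (x * σ x)
  g[cx²] {c} kc x = trans (g-homogeneous kc (x * x)) (cong (c *_) (trans (g-* x x) (g*g x)))

  -- With θ = 1 + 2d = |F*/K*|, the power a^θ lies in K and a a^θ = (a^{1+d})².
  ≡cx² : ∀ a → ∃[ c ] ∃[ x ] (InK c × c ≢ 0# × a ≡ c * (x * x))
  ≡cx² a with a ≟ 0#
  ... | yes refl = 1# , 0# , σ-1 , 0≢1 ∘ sym , solve 0 (con (+ 0) := con (+ 1) :* (con (+ 0) :* con (+ 0))) refl
  ... | no a≢0 = t ⁻¹[ t≢0 ] , a ^ suc d , InK-⁻¹ t∈K t≢0 , ⁻¹-≢0 t≢0 , sym a≡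
    where
    open ≡-Reasoning
    θ = suc (2 ℕ.* d)
    t = a ^ θ
    t≢0 : t ≢ 0#
    t≢0 = ^-≢0 θ a≢0
    t^r≡1 : t ^ r ≡ 1#
    t^r≡1 = *-cancelˡ a≢0 (begin
      a * t ^ r                          ≡⟨ cong (a *_) (^-assocʳ a θ r) ⟩
      a ^ suc (θ ℕ.* r)                  ≡⟨ cong (λ k → a ^ suc k) (ℕ.*-comm θ r) ⟩
      a ^ suc (r ℕ.* θ)                  ≡⟨ cong (a ^_) card-1≡ ⟨
      a ^ (q ℕ.^ (2 ℕ.* n ℕ.+ 1))        ≡⟨ x^[q^m]≡x a ⟩
      a                                  ≡⟨ *-identityʳ a ⟨
      a * 1#                             ∎)
    t∈K : InK t
    t∈K = trans (cong (t *_) t^r≡1) (*-identityʳ t)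
    a≡ : t ⁻¹[ t≢0 ] * (a ^ suc d * a ^ suc d) ≡ a
    a≡ = begin
      t ⁻¹[ t≢0 ] * (a ^ suc d * a ^ suc d)   ≡⟨ cong (t ⁻¹[ t≢0 ] *_) (^-homo-* a (suc d) (suc d)) ⟨
      t ⁻¹[ t≢0 ] * a ^ (suc d ℕ.+ suc d)     ≡⟨ cong (λ k → t ⁻¹[ t≢0 ] * a ^ suc k) (trans (ℕ.+-suc d d) (cong (λ e → suc (d ℕ.+ e)) (sym (ℕ.+-identityʳ d)))) ⟩
      t ⁻¹[ t≢0 ] * (a * t)                   ≡⟨ solve 3 (λ i a t → i :* (a :* t) := (t :* i) :* a) refl _ a t ⟩
      t * t ⁻¹[ t≢0 ] * a                     ≡⟨ cong (_* a) (*-inverseʳ t≢0) ⟩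
      1# * a                                  ≡⟨ *-identityˡ a ⟩
      a                                       ∎

  -- Expanding `g c * g c ≡ c * σ c` with `c = −(a + b)` and `g c = −(g a + g b)` gives
  -- `a σb + b σa = 2 g(a) g(b)`. Hence `(a σb − b σa)² = (a σb + b σa)² − 4 (a σa)(b σb)` vanishes.
  -- Nothing is divided by 2, so the argument covers every characteristic.
  g-collinear : ∀ {a b c} → a + b + c ≡ 0# → g a + g b + g c ≡ 0# → a * σ b ≡ b * σ a
  g-collinear {a} {b} {c} eq geq = x-y≡0⇒x≡y (x²≡0⇒x≡0 (begin
    (a * σ b - b * σ a) * (a * σ b - b * σ a)
      ≡⟨ solve 4 (λ a b s t → (a :* t :- b :* s) :* (a :* t :- b :* s)
           := (a :* t :+ b :* s) :* (a :* t :+ b :* s) :- con (+ 4) :* ((a :* s) :* (b :* t))) refl a b (σ a) (σ b) ⟩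
    e * e - 4# * (a * σ a * (b * σ b))
      ≡⟨ cong₂ (λ u v → u * u - 4# * v) e≡2gg (sym (cong₂ _*_ (g*g a) (g*g b))) ⟩
    ((1# + 1#) * (g a * g b)) * ((1# + 1#) * (g a * g b)) - 4# * (g a * g a * (g b * g b))
      ≡⟨ solve 2 (λ x y → ((con (+ 2)) :* (x :* y)) :* ((con (+ 2)) :* (x :* y)) :- con (+ 4) :* ((x :* x) :* (y :* y)) := con (+ 0)) refl (g a) (g b) ⟩
    0#  ∎))
    where
    open ≡-Reasoning
    4# = 1# + 1# + 1# + 1#
    e = a * σ b + b * σ a
    neg : ∀ {x y z} → x + y + z ≡ 0# → - (x + y) ≡ z
    neg {x} {y} {z} eq = x-y≡0⇒x≡y (trans (solve 3 (λ x y z → :- (x :+ y) :- z := :- (x :+ y :+ z)) refl x y z)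
      (trans (cong -_ eq) (solve 0 (:- con (+ 0) := con (+ 0)) refl)))
    e≡2gg : e ≡ (1# + 1#) * (g a * g b)
    e≡2gg = begin
      e
        ≡⟨ solve 4 (λ a b s t → a :* t :+ b :* s := (:- (a :+ b)) :* (:- (s :+ t)) :- (a :* s) :- b :* t) refl a b (σ a) (σ b) ⟩
      (- (a + b)) * (- (σ a + σ b)) - a * σ a - b * σ b
        ≡⟨ cong₂ (λ u v → (- (a + b)) * u - v - b * σ b) (trans (cong -_ (sym (σ-+ a b))) (sym (σ-neg (a + b)))) (sym (g*g a)) ⟩
      (- (a + b)) * σ (- (a + b)) - g a * g a - b * σ b
        ≡⟨ cong₂ (λ u v → u * σ u - g a * g a - v) (neg eq) (sym (g*g b)) ⟩
      c * σ c - g a * g a - g b * g b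
        ≡⟨ cong (λ u → u - g a * g a - g b * g b) (sym (g*g c)) ⟩
      g c * g c - g a * g a - g b * g b
        ≡⟨ cong (λ u → u * u - g a * g a - g b * g b) (sym (neg geq)) ⟩
      (- (g a + g b)) * (- (g a + g b)) - g a * g a - g b * g b
        ≡⟨ solve 2 (λ x y → (:- (x :+ y)) :* (:- (x :+ y)) :- x :* x :- y :* y := con (+ 2) :* (x :* y)) refl (g a) (g b) ⟩
      (1# + 1#) * (g a * g b) ∎

  -- h i + √k δ i is the quotient of c₁ x^{qⁱ} + √k y^{qⁱ} by c₁ x + √k y, so it is multiplicative
  -- along Frobenius like angles of rotation.
  module Rotation {c₁ c₂ : Carrier} (k₁ : InK c₁) (k₂ : InK c₂) (x y : Carrier)
    (norm : c₁ * (x * x) - c₂ * (y * y) ≡ 1#) where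

    k : Carrier
    k = c₁ * c₂

    h δ : ℕ → Carrier
    h i = c₁ * (x * σ^ i x) - c₂ * (y * σ^ i y)
    δ i = x * σ^ i y - y * σ^ i x

    h-0 : h 0 ≡ 1#
    h-0 = norm

    δ-0 : δ 0 ≡ 0#
    δ-0 = solve 2 (λ x y → x :* y :- y :* x := con (+ 0)) refl x y

    private
      X = σ x
      Y = σ y

      σ-form : ∀ u v → σ (c₁ * (x * u) - c₂ * (y * v)) ≡ c₁ * (X * σ u) - c₂ * (Y * σ v)
      σ-form u v = trans (σ-sub _ _) (cong₂ _-_ (lem k₁ x u) (lem k₂ y v))
        where
        lem : ∀ {c} → InK c → ∀ x u → σ (c * (x * u)) ≡ c * (σ x * σ u)
        lem kc x u = trans (σ-* _ _) (cong₂ _*_ kc (σ-* x u))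

      σ-δ : ∀ i → σ (δ i) ≡ X * σ^ (suc i) y - Y * σ^ (suc i) x
      σ-δ i = trans (σ-sub _ _) (cong₂ _-_ (σ-* _ _) (σ-* _ _))

      σ-norm : c₁ * (X * X) - c₂ * (Y * Y) ≡ 1#
      σ-norm = trans (sym (σ-form x y)) (trans (cong σ norm) σ-1)

    open ≡-Reasoning

    -- With `Tᵢ = h i + √k δ i` and `σ` fixing `√k`, this and `δ-suc` are the two components of
    -- `Tᵢ₊₁ = T₁ · σ Tᵢ`.
    h-suc : ∀ i → h (suc i) ≡ h 1 * σ (h i) + k * δ 1 * σ (δ i)
    h-suc i = begin
      h (suc i)
        ≡⟨ *-identityˡ _ ⟨
      -- The factor 1, read as the norm of `(X, Y)`, makes both sides of the same degree, so that a
      -- polynomial identity remains.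
      1# * h (suc i)
        ≡⟨ cong (_* h (suc i)) σ-norm ⟨
      (c₁ * (X * X) - c₂ * (Y * Y)) * h (suc i)
        ≡⟨ solve 8 (λ c₁ c₂ x y X Y Z W →
             (c₁ :* (X :* X) :- c₂ :* (Y :* Y)) :* (c₁ :* (x :* Z) :- c₂ :* (y :* W))
             := (c₁ :* (x :* X) :- c₂ :* (y :* Y)) :* (c₁ :* (X :* Z) :- c₂ :* (Y :* W))
                :+ c₁ :* c₂ :* (x :* Y :- y :* X) :* (X :* W :- Y :* Z)) refl c₁ c₂ x y X Y (σ^ (suc i) x) (σ^ (suc i) y) ⟩
      h 1 * (c₁ * (X * σ^ (suc i) x) - c₂ * (Y * σ^ (suc i) y)) + k * δ 1 * (X * σ^ (suc i) y - Y * σ^ (suc i) x)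
        ≡⟨ cong₂ (λ a b → h 1 * a + k * δ 1 * b) (sym (σ-form _ _)) (sym (σ-δ i)) ⟩
      h 1 * σ (h i) + k * δ 1 * σ (δ i) ∎

    δ-suc : ∀ i → δ (suc i) ≡ h 1 * σ (δ i) + δ 1 * σ (h i)
    δ-suc i = begin
      δ (suc i)
        ≡⟨ *-identityˡ _ ⟨
      1# * δ (suc i)
        ≡⟨ cong (_* δ (suc i)) σ-norm ⟨
      (c₁ * (X * X) - c₂ * (Y * Y)) * δ (suc i)
        ≡⟨ solve 8 (λ c₁ c₂ x y X Y Z W →
             (c₁ :* (X :* X) :- c₂ :* (Y :* Y)) :* (x :* W :- y :* Z)
             := (c₁ :* (x :* X) :- c₂ :* (y :* Y)) :* (X :* W :- Y :* Z)
                :+ (x :* Y :- y :* X) :* (c₁ :* (X :* Z) :- c₂ :* (Y :* W))) refl c₁ c₂ x y X Y (σ^ (suc i) x) (σ^ (suc i) y) ⟩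
      h 1 * (X * σ^ (suc i) y - Y * σ^ (suc i) x) + δ 1 * (c₁ * (X * σ^ (suc i) x) - c₂ * (Y * σ^ (suc i) y))
        ≡⟨ cong₂ (λ a b → h 1 * a + δ 1 * b) (sym (σ-δ i)) (sym (σ-form _ _)) ⟩
      h 1 * σ (δ i) + δ 1 * σ (h i) ∎

    -- Brahmagupta's identity: `h² − k δ²` is the product of the norms of `(x, y)` and `(X, Y)`,
    -- both equal to 1.
    kδ² : k * (δ 1 * δ 1) ≡ h 1 * h 1 - 1#
    kδ² = begin
      k * (δ 1 * δ 1)
        ≡⟨ solve 6 (λ c₁ c₂ x y X Y →
             c₁ :* c₂ :* ((x :* Y :- y :* X) :* (x :* Y :- y :* X))
             := (c₁ :* (x :* X) :- c₂ :* (y :* Y)) :* (c₁ :* (x :* X) :- c₂ :* (y :* Y))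
                :- (c₁ :* (x :* x) :- c₂ :* (y :* y)) :* (c₁ :* (X :* X) :- c₂ :* (Y :* Y))) refl c₁ c₂ x y X Y ⟩
      h 1 * h 1 - (c₁ * (x * x) - c₂ * (y * y)) * (c₁ * (X * X) - c₂ * (Y * Y))
        ≡⟨ cong₂ (λ a b → h 1 * h 1 - a * b) norm σ-norm ⟩
      h 1 * h 1 - 1# * 1#
        ≡⟨ cong (λ a → h 1 * h 1 - a) (*-identityˡ 1#) ⟩
      h 1 * h 1 - 1# ∎

  -- If h′ 1 = − h 1 then the angles add up to h′ i = (−1)ⁱ h i, and closing the orbit at i = 2n+1 gives 1 = −1.
  rotation-unique : 1# + 1# ≢ 0# → ∀ {c₁ c₂ c₃ c₄} → InK c₁ → InK c₂ → InK c₃ → InK c₄ → c₃ * c₄ ≢ 0# → ∀ x y z w →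
    c₁ * (x * x) - c₂ * (y * y) ≡ 1# → c₃ * (z * z) - c₄ * (w * w) ≡ 1# →
    c₃ * (z * σ z) - c₄ * (w * σ w) ≡ - (c₁ * (x * σ x) - c₂ * (y * σ y)) → ⊥
  rotation-unique 2≢0 k₁ k₂ k₃ k₄ k′≢0 x y z w norm norm′ h′≡-h = 2≢0 (begin
    1# + 1#                       ≡⟨ solve 0 (con (+ 2) := con (+ 1) :- (:- con (+ 1)) :* con (+ 1)) refl ⟩
    1# - (- 1#) * 1#              ≡⟨ cong₂ (λ a b → 1# - a * b) (ε-odd n) (trans hₘ h-0) ⟨
    1# - ε m * h m                ≡⟨ cong (λ a → 1# - a) (proj₁ (signs m)) ⟨
    1# - h′ m                     ≡⟨ cong (λ a → 1# - a) (trans h′ₘ h′-0) ⟩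
    1# - 1#                       ≡⟨ -‿inverseʳ 1# ⟩
    0#                            ∎)
    where
    open ≡-Reasoning
    open Rotation k₁ k₂ x y norm
    open Rotation k₃ k₄ z w norm′ using () renaming (k to k′; h to h′; δ to δ′; h-0 to h′-0; δ-0 to δ′-0; h-suc to h′-suc; δ-suc to δ′-suc; kδ² to k′δ′²)
    m = suc (n ℕ.+ n)

    hₘ : h m ≡ h 0
    hₘ = cong₂ (λ a b → _ * (x * a) - _ * (y * b)) (σ^m≡id x) (σ^m≡id y)

    h′ₘ : h′ m ≡ h′ 0
    h′ₘ = cong₂ (λ a b → _ * (z * a) - _ * (w * b)) (σ^m≡id z) (σ^m≡id w)

    ε : ℕ → Carrier
    ε i = (- 1#) ^ i

    InK-ε : ∀ i → InK (ε i)
    InK-ε zero    = σ-1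
    InK-ε (suc i) = InK-* (InK-neg σ-1) (InK-ε i)

    ε-odd : ∀ j → ε (suc (j ℕ.+ j)) ≡ - 1#
    ε-odd zero = *-identityʳ (- 1#)
    ε-odd (suc j) = trans (cong (λ i → ε (suc (suc i))) (ℕ.+-suc j j))
      (trans (solve 1 (λ e → (:- con (+ 1)) :* ((:- con (+ 1)) :* e) := e) refl (ε (suc (j ℕ.+ j)))) (ε-odd j))

    k′δ′²≡kδ² : k′ * (δ′ 1 * δ′ 1) ≡ k * (δ 1 * δ 1)
    k′δ′²≡kδ² = begin
      k′ * (δ′ 1 * δ′ 1)       ≡⟨ k′δ′² ⟩
      h′ 1 * h′ 1 - 1#         ≡⟨ cong (λ a → a * a - 1#) h′≡-h ⟩
      (- h 1) * (- h 1) - 1#   ≡⟨ solve 1 (λ a → (:- a) :* (:- a) :- con (+ 1) := a :* a :- con (+ 1)) refl (h 1) ⟩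
      h 1 * h 1 - 1#           ≡⟨ kδ² ⟨
      k * (δ 1 * δ 1)          ∎

    -- Rescaling by `κ` identifies `√k` with `κ √k′`. If `δ 1` vanishes then so does `δ′ 1`; the
    -- value `κ = 1` is then a default for which `k′ κ² = k` may fail, so this relation is kept
    -- multiplied by `δ 1`.
    ratio : ∃[ κ ] (InK κ × δ′ 1 ≡ κ * δ 1 × k′ * (κ * κ) * δ 1 ≡ k * δ 1)
    ratio with δ 1 ≟ 0#
    ... | yes δ≡0 = 1# , σ-1 , trans δ′≡0 (sym (trans (*-identityˡ (δ 1)) δ≡0)) ,
      trans (*δ≡0 (k′ * (1# * 1#))) (sym (*δ≡0 k))
      where
      *δ≡0 : ∀ a → a * δ 1 ≡ 0#
      *δ≡0 a = trans (cong (a *_) δ≡0) (zeroʳ a)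
      δ′≡0 : δ′ 1 ≡ 0#
      δ′≡0 = x²≡0⇒x≡0 (x*y≡0⇒y≡0 k′≢0 (trans k′δ′²≡kδ²
        (trans (cong (λ a → k * (a * a)) δ≡0) (solve 1 (λ k → k :* (con (+ 0) :* con (+ 0)) := con (+ 0)) refl k))))
    ... | no δ≢0 = κ , σ²-fixed⇒InK σσκ≡κ , δ′≡κδ , cong (_* δ 1) k′κ²≡k
      where
      κ = δ′ 1 * δ 1 ⁻¹[ δ≢0 ]
      δ′≡κδ : δ′ 1 ≡ κ * δ 1
      δ′≡κδ = sym (trans (solve 3 (λ a i b → a :* i :* b := a :* (b :* i)) refl (δ′ 1) (δ 1 ⁻¹[ δ≢0 ]) (δ 1))
        (trans (cong (δ′ 1 *_) (*-inverseʳ δ≢0)) (*-identityʳ _)))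
      k′κ²≡k : k′ * (κ * κ) ≡ k
      k′κ²≡k = *-cancelˡ (*-≢0 δ≢0 δ≢0) (begin
        δ 1 * δ 1 * (k′ * (κ * κ))             ≡⟨ solve 3 (λ d k κ → d :* d :* (k :* (κ :* κ)) := k :* ((κ :* d) :* (κ :* d))) refl (δ 1) k′ κ ⟩
        k′ * ((κ * δ 1) * (κ * δ 1))           ≡⟨ cong (λ a → k′ * (a * a)) δ′≡κδ ⟨
        k′ * (δ′ 1 * δ′ 1)                     ≡⟨ k′δ′²≡kδ² ⟩
        k * (δ 1 * δ 1)                        ≡⟨ *-comm _ _ ⟩
        δ 1 * δ 1 * k                          ∎)
      -- The square `κ * κ` is the quotient `k / k′` of elements of K. The resulting `σ κ = ± κ`
      -- gives `σ (σ κ) = κ`, and the odd degree puts `κ` itself in K.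
      σκ²≡κ² : σ κ * σ κ ≡ κ * κ
      σκ²≡κ² = *-cancelˡ k′≢0 (begin
        k′ * (σ κ * σ κ)      ≡⟨ cong₂ _*_ (InK-* k₃ k₄) (σ-* κ κ) ⟨
        σ k′ * σ (κ * κ)      ≡⟨ σ-* k′ (κ * κ) ⟨
        σ (k′ * (κ * κ))      ≡⟨ cong σ k′κ²≡k ⟩
        σ k                   ≡⟨ InK-* k₁ k₂ ⟩
        k                     ≡⟨ k′κ²≡k ⟨
        k′ * (κ * κ)          ∎)
      σσκ≡κ : σ (σ κ) ≡ κ
      σσκ≡κ = [ (λ σκ≡κ → trans (cong σ σκ≡κ) σκ≡κ)
              , (λ σκ≡-κ → trans (cong σ σκ≡-κ) (trans (σ-neg κ)
                  (trans (cong -_ σκ≡-κ) (solve 1 (λ a → :- (:- a) := a) refl κ)))) ]′ (x²≡y²⇒x≡±y σκ²≡κ²)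

    κ : Carrier
    κ = proj₁ ratio
    κ∈K : InK κ
    κ∈K = proj₁ (proj₂ ratio)
    δ′≡κδ : δ′ 1 ≡ κ * δ 1
    δ′≡κδ = proj₁ (proj₂ (proj₂ ratio))
    k′κ²δ≡kδ : k′ * (κ * κ) * δ 1 ≡ k * δ 1
    k′κ²δ≡kδ = proj₂ (proj₂ (proj₂ ratio))

    -- In terms of angles, `T′ᵢ` is `(−1)ⁱ` times the conjugate of `Tᵢ`, where `√k = κ √k′`. The
    -- induction multiplies by `T′₁ = −` conjugate of `T₁`.
    signs : ∀ i → h′ i ≡ ε i * h i × δ′ i ≡ - ε i * κ * δ i
    signs zero = trans h′-0 (sym (trans (*-identityˡ _) h-0)) ,
      trans δ′-0 (sym (trans (cong (- 1# * κ *_) δ-0) (zeroʳ _)))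
    signs (suc i) = h-step , δ-step
      where
      σh′ : σ (h′ i) ≡ ε i * σ (h i)
      σh′ = trans (cong σ (proj₁ (signs i))) (trans (σ-* _ _) (cong (_* σ (h i)) (InK-ε i)))
      σδ′ : σ (δ′ i) ≡ - ε i * κ * σ (δ i)
      σδ′ = trans (cong σ (proj₂ (signs i))) (trans (σ-* _ _) (cong (_* σ (δ i)) (InK-* (InK-neg (InK-ε i)) κ∈K)))
      h-step : h′ (suc i) ≡ - 1# * ε i * h (suc i)
      h-step = begin
        h′ (suc i)
          ≡⟨ h′-suc i ⟩
        h′ 1 * σ (h′ i) + k′ * δ′ 1 * σ (δ′ i)
          ≡⟨ cong₂ _+_ (cong₂ _*_ h′≡-h σh′) (cong₂ _*_ (cong (k′ *_) δ′≡κδ) σδ′) ⟩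
        - h 1 * (ε i * σ (h i)) + k′ * (κ * δ 1) * (- ε i * κ * σ (δ i))
          ≡⟨ solve 7 (λ h e a k κ d b → (:- h) :* (e :* a) :+ k :* (κ :* d) :* ((:- e) :* κ :* b)
               := (:- con (+ 1)) :* e :* (h :* a :+ (k :* (κ :* κ) :* d) :* b)) refl (h 1) (ε i) (σ (h i)) k′ κ (δ 1) (σ (δ i)) ⟩
        - 1# * ε i * (h 1 * σ (h i) + (k′ * (κ * κ) * δ 1) * σ (δ i))
          ≡⟨ cong (λ a → - 1# * ε i * (h 1 * σ (h i) + a * σ (δ i))) k′κ²δ≡kδ ⟩
        - 1# * ε i * (h 1 * σ (h i) + k * δ 1 * σ (δ i))
          ≡⟨ cong (- 1# * ε i *_) (h-suc i) ⟨
        - 1# * ε i * h (suc i) ∎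
      δ-step : δ′ (suc i) ≡ - (- 1# * ε i) * κ * δ (suc i)
      δ-step = begin
        δ′ (suc i)
          ≡⟨ δ′-suc i ⟩
        h′ 1 * σ (δ′ i) + δ′ 1 * σ (h′ i)
          ≡⟨ cong₂ _+_ (cong₂ _*_ h′≡-h σδ′) (cong₂ _*_ δ′≡κδ σh′) ⟩
        - h 1 * (- ε i * κ * σ (δ i)) + κ * δ 1 * (ε i * σ (h i))
          ≡⟨ solve 6 (λ h e a κ d b → (:- h) :* ((:- e) :* κ :* b) :+ κ :* d :* (e :* a)
               := (:- ((:- con (+ 1)) :* e)) :* κ :* (h :* b :+ d :* a)) refl (h 1) (ε i) (σ (h i)) κ (δ 1) (σ (δ i)) ⟩
        - (- 1# * ε i) * κ * (h 1 * σ (δ i) + δ 1 * σ (h i))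
          ≡⟨ cong (- (- 1# * ε i) * κ *_) (δ-suc i) ⟨
        - (- 1# * ε i) * κ * δ (suc i) ∎

-- Counting in finite sets.

-- Punching out a missed value would inject `Fin (suc n)` into `Fin n`.
Fin-injective⇒surjective : ∀ {n} (f : Fin n → Fin n) → Injective _≡_ _≡_ f → ∀ y → ∃[ x ] f x ≡ y
Fin-injective⇒surjective {suc n} f inj y with Fin.any? (λ x → f x Fin.≟ y)
... | yes hit  = hit
... | no  miss = contradiction (Fin.injective⇒≤ {f = λ x → punchOut (y≢f x)} (λ {x} {x′} → inj ∘ Fin.punchOut-injective (y≢f x) (y≢f x′))) ℕ.1+n≰n
  where
  y≢f : ∀ x → y ≢ f x
  y≢f x y≡fx = miss (x , sym y≡fx)

injective⇒surjective : ∀ {A : Set} {n} → A ↔ Fin n → (f : A → A) → Injective _≡_ _≡_ f → ∀ y → ∃[ x ] f x ≡ y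
injective⇒surjective A↔Fin f inj y =
  let i , eq = Fin-injective⇒surjective (to ∘ f ∘ from) (from-injective ∘ inj ∘ to-injective) (to y)
  in from i , to-injective eq
  where
  open Inverse A↔Fin
  to-injective : Injective _≡_ _≡_ to
  to-injective {x} {x′} eq = trans (sym (strictlyInverseʳ x)) (trans (cong from eq) (strictlyInverseʳ x′))
  from-injective : Injective _≡_ _≡_ from
  from-injective {x} {x′} eq = trans (sym (strictlyInverseˡ x)) (trans (cong to eq) (strictlyInverseˡ x′))

length-filter+filter-¬ : ∀ {A : Set} {P : A → Set} (P? : Decidable P) xs →
  length (filter P? xs) ℕ.+ length (filter (¬? ∘ P?) xs) ≡ length xs
length-filter+filter-¬ P? [] = refl
length-filter+filter-¬ P? (x ∷ xs) with P? x
... | yes _ = cong suc (length-filter+filter-¬ P? xs)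
... | no  _ = trans (ℕ.+-suc _ _) (cong suc (length-filter+filter-¬ P? xs))

-- The elements related to the first `y` are split off, at most `b` of them, and the others are
-- covered by the remaining `ys`.
length≤cover : ∀ {A B : Set} {R : B → A → Set} (R? : ∀ y → Decidable (R y)) b →
  (∀ y {xs} → Unique xs → All (R y) xs → length xs ℕ.≤ b) →
  ∀ ys {xs} → Unique xs → All (λ x → Any (λ y → R y x) ys) xs → length xs ℕ.≤ length ys ℕ.* b
length≤cover R? b small [] {[]} _ _ = ℕ.z≤n
length≤cover R? b small [] {_ ∷ _} _ (() ∷ _)
length≤cover {R = R} R? b small (y ∷ ys) {xs} uxs cover = subst (ℕ._≤ b ℕ.+ length ys ℕ.* b) (length-filter+filter-¬ (R? y) xs)
  (ℕ.+-mono-≤ (small y (Unique.filter⁺ (R? y) uxs) (All.all-filter (R? y) xs))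
    (length≤cover R? b small ys (Unique.filter⁺ (¬? ∘ R? y) uxs)
      (All.zipWith rest (All.all-filter (¬? ∘ R? y) xs , All.filter⁺ (¬? ∘ R? y) cover))))
  where
  rest : ∀ {x} → ¬ R y x × Any (λ y → R y x) (y ∷ ys) → Any (λ y → R y x) ys
  rest (¬Ryx , here Ryx) = contradiction Ryx ¬Ryx
  rest (_    , there p)  = p

-- The bijection `Φ` and the absence of common chords.

module Caps (F : FiniteField) (r d n : ℕ)
  (σ-+ : PowerAdditive F (suc r))
  (card≡ : FiniteField.card F ≡ suc r ℕ.^ (2 ℕ.* n ℕ.+ 1))
  (card-1≡ : suc r ℕ.^ (2 ℕ.* n ℕ.+ 1) ≡ suc (r ℕ.* suc (2 ℕ.* d)))
  where
  open FiniteField F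
  open OddExtension F r d n σ-+ card≡ card-1≡
  open Geometry F q hiding (InK)
  open ≡-Reasoning

  module _ (α : Carrier) (α∈K : InK α) (α≢0 : α ≢ 0#) (α≢1 : α ≢ 1#)
    (parity : (1# + 1# ≢ 0# × α ≡ - 1#) ⊎ 1# + 1# ≡ 0#) where

    -- Write `a`, `a − 1`, `b`, `b − 1` as elements of K times squares. The differences
    -- `a − (a − 1) = 1` and `b − (b − 1) = 1` are the two norm conditions, the differences of `g`
    -- are the values `h 1` and `h′ 1`, and `α = −1` makes them opposite.
    no-common-chord-odd : 1# + 1# ≢ 0# → α ≡ - 1# → ∀ a b → g a - g (a - 1#) ≢ α * (g b - g (b - 1#))
    no-common-chord-odd 2≢0 α≡-1 a b eq with ≡cx² a | ≡cx² (a - 1#) | ≡cx² b | ≡cx² (b - 1#)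
    ... | c₁ , x , k₁ , _ , a≡ | c₂ , y , k₂ , _ , a-1≡ | c₃ , z , k₃ , c₃≢0 , b≡ | c₄ , w , k₄ , c₄≢0 , b-1≡ =
      rotation-unique 2≢0 k₁ k₂ k₃ k₄ (*-≢0 c₃≢0 c₄≢0) x y z w (norm a≡ a-1≡) (norm b≡ b-1≡) (begin
        c₃ * (z * σ z) - c₄ * (w * σ w)            ≡⟨ cong₂ _-_ (g≡ k₃ b≡) (g≡ k₄ b-1≡) ⟨
        g b - g (b - 1#)                           ≡⟨ solve 1 (λ h → h := :- ((:- con (+ 1)) :* h)) refl (g b - g (b - 1#)) ⟩
        - (- 1# * (g b - g (b - 1#)))              ≡⟨ cong (λ t → - (t * (g b - g (b - 1#)))) α≡-1 ⟨
        - (α * (g b - g (b - 1#)))                 ≡⟨ cong -_ eq ⟨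
        - (g a - g (a - 1#))                       ≡⟨ cong -_ (cong₂ _-_ (g≡ k₁ a≡) (g≡ k₂ a-1≡)) ⟩
        - (c₁ * (x * σ x) - c₂ * (y * σ y))        ∎)
      where
      g≡ : ∀ {a c x} → InK c → a ≡ c * (x * x) → g a ≡ c * (x * σ x)
      g≡ {x = x} kc a≡ = trans (cong g a≡) (g[cx²] kc x)
      norm : ∀ {a s t} → a ≡ s → a - 1# ≡ t → s - t ≡ 1#
      norm {a} refl refl = solve 1 (λ a → a :- (a :- con (+ 1)) := con (+ 1)) refl a

    -- Squaring turns the equation into u + σ u = 1 − α² for u = a − α² b; then σ² u = u, so u ∈ K and u + u = 0.
    no-common-chord-even : 1# + 1# ≡ 0# → ∀ a b → g a - g (a - 1#) ≢ α * (g b - g (b - 1#))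
    no-common-chord-even 2≡0 a b eq = contradiction (x²≡y²⇒x≡±y α²≡1²)
      [ α≢1 , (λ α≡-1 → α≢1 (trans α≡-1 (sym (x-y≡0⇒x≡y (trans (solve 0 (con (+ 1) :- (:- con (+ 1)) := con (+ 2)) refl) 2≡0))))) ]′
      where
      square : ∀ a → (g a - g (a - 1#)) * (g a - g (a - 1#)) ≡ 1# - (a + σ a)
      square a = begin
        (g a - g (a - 1#)) * (g a - g (a - 1#))
          ≡⟨ solve 2 (λ x y → (x :- y) :* (x :- y) := x :* x :+ y :* y :- con (+ 2) :* (x :* y)) refl (g a) (g (a - 1#)) ⟩
        g a * g a + g (a - 1#) * g (a - 1#) - (1# + 1#) * (g a * g (a - 1#))
          ≡⟨ cong₂ (λ x y → x + y - (1# + 1#) * (g a * g (a - 1#))) (g*g a)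
               (trans (g*g (a - 1#)) (cong ((a - 1#) *_) (trans (σ-sub a 1#) (cong (λ x → σ a - x) σ-1)))) ⟩
        a * σ a + (a - 1#) * (σ a - 1#) - (1# + 1#) * (g a * g (a - 1#))
          ≡⟨ solve 3 (λ a s z → a :* s :+ (a :- con (+ 1)) :* (s :- con (+ 1)) :- con (+ 2) :* z
               := con (+ 1) :- (a :+ s) :+ con (+ 2) :* (a :* s :- z)) refl a (σ a) (g a * g (a - 1#)) ⟩
        1# - (a + σ a) + (1# + 1#) * (a * σ a - g a * g (a - 1#))
          ≡⟨ cong (λ t → 1# - (a + σ a) + t * (a * σ a - g a * g (a - 1#))) 2≡0 ⟩
        1# - (a + σ a) + 0# * (a * σ a - g a * g (a - 1#))
          ≡⟨ solve 2 (λ x y → x :+ con (+ 0) :* y := x) refl (1# - (a + σ a)) _ ⟩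
        1# - (a + σ a) ∎
      u τ : Carrier
      u = a - α * α * b
      τ = 1# - α * α
      squared : 1# - (a + σ a) ≡ α * α * (1# - (b + σ b))
      squared = begin
        1# - (a + σ a)
          ≡⟨ square a ⟨
        (g a - g (a - 1#)) * (g a - g (a - 1#))
          ≡⟨ cong (λ t → t * t) eq ⟩
        α * (g b - g (b - 1#)) * (α * (g b - g (b - 1#)))
          ≡⟨ solve 2 (λ α h → α :* h :* (α :* h) := α :* α :* (h :* h)) refl α (g b - g (b - 1#)) ⟩
        α * α * ((g b - g (b - 1#)) * (g b - g (b - 1#)))
          ≡⟨ cong (α * α *_) (square b) ⟩
        α * α * (1# - (b + σ b)) ∎
      σu≡τ-u : σ u ≡ τ - u
      σu≡τ-u = begin
        σ u
          ≡⟨ σ-sub a (α * α * b) ⟩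
        σ a - σ (α * α * b)
          ≡⟨ cong (λ t → σ a - t) (trans (σ-* (α * α) b) (cong (_* σ b) (InK-* α∈K α∈K))) ⟩
        σ a - α * α * σ b
          ≡⟨ solve 5 (λ a s e b t → s :- e :* t
               := (con (+ 1) :- e :- (a :- e :* b)) :+ (e :* (con (+ 1) :- (b :+ t)) :- (con (+ 1) :- (a :+ s))))
               refl a (σ a) (α * α) b (σ b) ⟩
        (τ - u) + (α * α * (1# - (b + σ b)) - (1# - (a + σ a)))
          ≡⟨ cong (_+_ (τ - u)) (x≡y⇒x-y≡0 (sym squared)) ⟩
        (τ - u) + 0#
          ≡⟨ +-identityʳ _ ⟩
        τ - u ∎
      τ∈K : InK τ
      τ∈K = trans (σ-sub 1# (α * α)) (cong₂ _-_ σ-1 (InK-* α∈K α∈K))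
      σσu≡u : σ (σ u) ≡ u
      σσu≡u = begin
        σ (σ u)          ≡⟨ cong σ σu≡τ-u ⟩
        σ (τ - u)        ≡⟨ σ-sub τ u ⟩
        σ τ - σ u        ≡⟨ cong₂ _-_ τ∈K σu≡τ-u ⟩
        τ - (τ - u)      ≡⟨ solve 2 (λ t u → t :- (t :- u) := u) refl τ u ⟩
        u                ∎
      α²≡1² : α * α ≡ 1# * 1#
      α²≡1² = sym (trans (*-identityˡ 1#) (x-y≡0⇒x≡y (begin
        τ                  ≡⟨ solve 2 (λ t u → t := (t :- u) :+ u) refl τ u ⟩
        (τ - u) + u        ≡⟨ cong (_+ u) (trans (sym σu≡τ-u) (σ²-fixed⇒InK σσu≡u)) ⟩
        u + u              ≡⟨ solve 1 (λ u → u :+ u := con (+ 2) :* u) refl u ⟩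
        (1# + 1#) * u      ≡⟨ cong (_* u) 2≡0 ⟩
        0# * u             ≡⟨ zeroˡ u ⟩
        0#                 ∎)))

    no-common-chord : ∀ a b → g a - g (a - 1#) ≢ α * (g b - g (b - 1#))
    no-common-chord = [ (λ (2≢0 , α≡-1) → no-common-chord-odd 2≢0 α≡-1) , no-common-chord-even ]′ parity

    -- The sum of `(a , g a)` and `(b , α g b)`. Zero arguments are allowed, so that vectors over a
    -- single one of the two sets are values as well.
    Φ : V → V
    Φ (a , b) = a + b , g a + α * g b

    -- The hypotheses give `a − a′ = b′ − b` and `g a − g a′ = α (g b′ − g b)`. If the common
    -- difference is nonzero, dividing by it normalises both differences to 1, by multiplicativity
    -- of `g`, and contradicts `no-common-chord`.
    Φ-injective : ∀ {a b a′ b′} → a + b ≡ a′ + b′ → g a + α * g b ≡ g a′ + α * g b′ → a ≡ a′ × b ≡ b′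
    Φ-injective {a} {b} {a′} {b′} eq geq with (a - a′) ≟ 0#
    ... | yes a-a′≡0 = a≡a′ , +-cancelʳ a (trans (+-comm b a) (trans eq (trans (+-comm a′ b′) (cong (_+_ b′) (sym a≡a′)))))
      where a≡a′ = x-y≡0⇒x≡y a-a′≡0
    ... | no a-a′≢0 = contradiction chord (no-common-chord (i * a) (i * b′))
      where
      i = (a - a′) ⁻¹[ a-a′≢0 ]
      shift : ∀ {x y} → x - y ≡ a - a′ → i * y ≡ i * x - 1#
      shift {x} {y} x-y≡ = begin
        i * y                        ≡⟨ solve 3 (λ i x y → i :* y := i :* x :- (x :- y) :* i) refl i x y ⟩
        i * x - (x - y) * i          ≡⟨ cong (λ t → i * x - t * i) x-y≡ ⟩
        i * x - (a - a′) * i         ≡⟨ cong (λ t → i * x - t) (*-inverseʳ a-a′≢0) ⟩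
        i * x - 1#                   ∎
      b′-b≡ : b′ - b ≡ a - a′
      b′-b≡ = x-y≡0⇒x≡y (trans (solve 4 (λ a b c d → d :- b :- (a :- c) := (c :+ d) :- (a :+ b)) refl a b a′ b′) (x≡y⇒x-y≡0 (sym eq)))
      scale : ∀ x y → x - y ≡ a - a′ → g (i * x) - g (i * x - 1#) ≡ g i * (g x - g y)
      scale x y x-y≡ = begin
        g (i * x) - g (i * x - 1#)       ≡⟨ cong (λ t → g (i * x) - g t) (shift x-y≡) ⟨
        g (i * x) - g (i * y)            ≡⟨ cong₂ _-_ (g-* i x) (g-* i y) ⟩
        g i * g x - g i * g y            ≡⟨ solve 3 (λ i x y → i :* x :- i :* y := i :* (x :- y)) refl (g i) (g x) (g y) ⟩
        g i * (g x - g y)                ∎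
      chord : g (i * a) - g (i * a - 1#) ≡ α * (g (i * b′) - g (i * b′ - 1#))
      chord = begin
        g (i * a) - g (i * a - 1#)                    ≡⟨ scale a a′ refl ⟩
        g i * (g a - g a′)                            ≡⟨ solve 5 (λ i x y z w → i :* (x :- z) := i :* ((x :+ y) :- z :- y :+ w :- w)) refl (g i) (g a) (α * g b) (g a′) (α * g b′) ⟩
        g i * ((g a + α * g b) - g a′ - α * g b + α * g b′ - α * g b′)
                                                      ≡⟨ cong (λ t → g i * (t - g a′ - α * g b + α * g b′ - α * g b′)) geq ⟩
        g i * ((g a′ + α * g b′) - g a′ - α * g b + α * g b′ - α * g b′)
                                                      ≡⟨ solve 5 (λ i α y z w → i :* ((z :+ α :* w) :- z :- α :* y :+ α :* w :- α :* w) := α :* (i :* (w :- y))) refl (g i) α (g b) (g a′) (g b′) ⟩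
        α * (g i * (g b′ - g b))                      ≡⟨ cong (α *_) (scale b′ b b′-b≡) ⟨
        α * (g (i * b′) - g (i * b′ - 1#))            ∎

    Φ-surjective : ∀ v → ∃[ a ] ∃[ b ] Φ (a , b) ≡ v
    Φ-surjective v with injective⇒surjective (↔-sym Fin.*↔× ↔-∘ (enum ×-↔ enum)) Φ inj v
      where
      inj : Injective _≡_ _≡_ Φ
      inj eq with ,-injective eq
      ... | eq₁ , eq₂ with Φ-injective eq₁ eq₂
      ...   | refl , refl = refl
    ... | (a , b) , eq = a , b , eq

    -- The points of the two sets and their collinearities.

    OnCone : Carrier → V → Set
    OnCone ω (a , b) = a ≢ 0# × b ≡ ω * g a

    𝒱⇒OnCone : ∀ {ω v} → 𝒱 ω v → OnCone ω v
    𝒱⇒OnCone {ω} (x , x≢0 , c , c∈K , c≢0 , refl) = *-≢0 c≢0 (^-≢0 2 x≢0) , (begin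
      c * (ω * (x * σ x))          ≡⟨ solve 3 (λ c ω y → c :* (ω :* y) := ω :* (c :* y)) refl c ω (x * σ x) ⟩
      ω * (c * (x * σ x))          ≡⟨ cong (ω *_) (g[cx²] c∈K x) ⟨
      ω * g (c * (x * x))          ≡⟨ cong (λ y → ω * g (c * (x * y))) (*-identityʳ x) ⟨
      ω * g (c * x ^ 2)            ∎)

    -- The scalar `c` in `a = c x²` also serves for the second coordinate, because
    -- `g (c x²) = c x^(q+1)`.
    OnCone⇒𝒱 : ∀ {ω v} → OnCone ω v → 𝒱 ω v
    OnCone⇒𝒱 {ω} {a , b} (a≢0 , b≡ωga) with ≡cx² a
    ... | c , x , c∈K , c≢0 , a≡cx² = x , x≢0 , c , c∈K , c≢0 , cong₂ _,_
      (trans a≡cx² (cong (λ y → c * (x * y)) (sym (*-identityʳ x))))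
      (begin
        b                        ≡⟨ b≡ωga ⟩
        ω * g a                  ≡⟨ cong (λ t → ω * g t) a≡cx² ⟩
        ω * g (c * (x * x))      ≡⟨ cong (ω *_) (g[cx²] c∈K x) ⟩
        ω * (c * (x * σ x))      ≡⟨ solve 3 (λ c ω y → ω :* (c :* y) := c :* (ω :* y)) refl c ω (x * σ x) ⟩
        c * (ω * (x * σ x))      ∎)
      where
      x≢0 : x ≢ 0#
      x≢0 x≡0 = a≢0 (trans a≡cx² (trans (cong (λ y → c * (y * y)) x≡0)
        (solve 1 (λ c → c :* (con (+ 0) :* con (+ 0)) := con (+ 0)) refl c)))

    S : V → Set
    S v = 𝒱 1# v ⊎ 𝒱 α v

    ∼-refl : ∀ v → v ∼ v
    ∼-refl (a , b) = 1# , σ-1 , 0≢1 ∘ sym , sym (cong₂ _,_ (*-identityˡ a) (*-identityˡ b))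

    -- Proportionality gives `b = c a`, hence `g b = c g a` by homogeneity; comparing second
    -- coordinates would force `α = 1`.
    cones-≁ : ∀ {a b} → a ≢ 0# → ¬ ((a , 1# * g a) ∼ (b , α * g b))
    cones-≁ {a} {b} a≢0 (c , c∈K , c≢0 , eq) = α≢1 (*-cancelˡ (g-≢0 (*-≢0 c≢0 a≢0)) (begin
      g (c * a) * α            ≡⟨ cong (λ t → g t * α) (proj₁ (,-injective eq)) ⟨
      g b * α                  ≡⟨ *-comm (g b) α ⟩
      α * g b                  ≡⟨ proj₂ (,-injective eq) ⟩
      c * (1# * g a)           ≡⟨ cong (c *_) (*-identityˡ (g a)) ⟩
      c * g a                  ≡⟨ g-homogeneous c∈K a ⟨
      g (c * a)                ≡⟨ *-identityʳ _ ⟨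
      g (c * a) * 1#           ∎))

    σ-proportional⇒∼ : ∀ {ω a b} → a ≢ 0# → b ≢ 0# → a * σ b ≡ b * σ a → (a , ω * g a) ∼ (b , ω * g b)
    σ-proportional⇒∼ {ω} {a} {b} a≢0 b≢0 eq = t , t∈K , *-≢0 b≢0 (⁻¹-≢0 a≢0) , cong₂ _,_ b≡ta (begin
      ω * g b            ≡⟨ cong (λ x → ω * g x) b≡ta ⟩
      ω * g (t * a)      ≡⟨ cong (ω *_) (g-homogeneous t∈K a) ⟩
      ω * (t * g a)      ≡⟨ solve 3 (λ ω t x → ω :* (t :* x) := t :* (ω :* x)) refl ω t (g a) ⟩
      t * (ω * g a)      ∎)
      where
      t = b * a ⁻¹[ a≢0 ]
      b≡ta : b ≡ t * a
      b≡ta = sym (trans (solve 3 (λ a b i → b :* i :* a := b :* (a :* i)) refl a b _)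
        (trans (cong (b *_) (*-inverseʳ a≢0)) (*-identityʳ b)))
      t∈K : InK t
      t∈K = *-cancelˡ (*-≢0 a≢0 (^-≢0 q a≢0)) (begin
        a * σ a * σ t          ≡⟨ solve 3 (λ a s t → a :* s :* t := a :* (t :* s)) refl a (σ a) (σ t) ⟩
        a * (σ t * σ a)        ≡⟨ cong (a *_) (σ-* t a) ⟨
        a * σ (t * a)          ≡⟨ cong (λ x → a * σ x) b≡ta ⟨
        a * σ b                ≡⟨ eq ⟩
        b * σ a                ≡⟨ cong (_* σ a) b≡ta ⟩
        t * a * σ a            ≡⟨ solve 3 (λ a s t → t :* a :* s := a :* s :* t) refl a (σ a) t ⟩
        a * σ a * t            ∎)

    -- Nonzero first coordinates force both coefficients to be nonzero. In `isCap` this disposes of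
    -- relations with a vanishing coefficient.
    dependent-pair⇒∼ : ∀ {u v b c} → InK b → InK c → proj₁ u ≢ 0# → proj₁ v ≢ 0# → ¬ (b ≡ 0# × c ≡ 0#) →
      b * proj₁ u + c * proj₁ v ≡ 0# → b * proj₂ u + c * proj₂ v ≡ 0# → u ∼ v
    dependent-pair⇒∼ {u₁ , u₂} {v₁ , v₂} {b} {c} b∈K c∈K u₁≢0 v₁≢0 bc≢0 eq₁ eq₂ =
      - b * i , InK-* (InK-neg b∈K) (InK-⁻¹ c∈K c≢0) , *-≢0 (neg-≢0 b≢0) (⁻¹-≢0 c≢0) , cong₂ _,_ (lem u₁ v₁ eq₁) (lem u₂ v₂ eq₂)
      where
      c≢0 : c ≢ 0#
      c≢0 refl = bc≢0 (x*y≡0⇒y≡0 u₁≢0 (trans (solve 3 (λ b u v → u :* b := b :* u :+ con (+ 0) :* v) refl b u₁ v₁) eq₁) , refl)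
      b≢0 : b ≢ 0#
      b≢0 refl = bc≢0 (refl , x*y≡0⇒y≡0 v₁≢0 (trans (solve 3 (λ c u v → v :* c := con (+ 0) :* u :+ c :* v) refl c u₁ v₁) eq₁))
      i = c ⁻¹[ c≢0 ]
      lem : ∀ x y → b * x + c * y ≡ 0# → y ≡ - b * i * x
      lem x y eq = begin
        y                                        ≡⟨ *-identityˡ y ⟨
        1# * y                                   ≡⟨ cong (_* y) (*-inverseʳ c≢0) ⟨
        c * i * y                                ≡⟨ solve 5 (λ b c i x y → c :* i :* y := i :* (b :* x :+ c :* y) :+ (:- b) :* i :* x) refl b c i x y ⟩
        i * (b * x + c * y) + - b * i * x        ≡⟨ cong (λ t → i * t + - b * i * x) eq ⟩
        i * 0# + - b * i * x                     ≡⟨ solve 2 (λ i x → i :* con (+ 0) :+ x := x) refl i (- b * i * x) ⟩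
        - b * i * x                              ∎

    -- If all three `ω` agree, they cancel and `g-collinear` applies. Otherwise exactly two agree,
    -- and injectivity of `Φ` forces the remaining argument to be 0.
    cone-collinear : ∀ {ω₁ ω₂ ω₃ a b c} → (ω₁ ≡ 1# ⊎ ω₁ ≡ α) → (ω₂ ≡ 1# ⊎ ω₂ ≡ α) → (ω₃ ≡ 1# ⊎ ω₃ ≡ α) →
      a ≢ 0# → b ≢ 0# → c ≢ 0# → a + b + c ≡ 0# → ω₁ * g a + ω₂ * g b + ω₃ * g c ≡ 0# → ω₁ ≡ ω₂ × a * σ b ≡ b * σ a
    cone-collinear {a = a} {b} {c} i₁ i₂ i₃ a≢0 b≢0 c≢0 eq geq = go i₁ i₂ i₃ geq
      where
      cancel : ∀ {ω x y z} → ω ≢ 0# → ω * x + ω * y + ω * z ≡ 0# → x + y + z ≡ 0#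
      cancel ω≢0 eq = x*y≡0⇒y≡0 ω≢0 (trans (solve 4 (λ ω x y z → ω :* (x :+ y :+ z) := ω :* x :+ ω :* y :+ ω :* z) refl _ _ _ _) eq)
      -- Moving `y` to the other side gives `Φ (x , z) = Φ (− y , 0)`; in `mixed′` it gives
      -- `Φ (z , x) = Φ (0 , − y)`.
      mixed : ∀ x y z → x + y + z ≡ 0# → 1# * g x + 1# * g y + α * g z ≡ 0# → z ≡ 0#
      mixed x y z eq geq = proj₂ (Φ-injective {x} {z} { - y} {0#}
        (trans (solve 3 (λ x y z → x :+ z := (x :+ y :+ z) :- y) refl x y z)
          (trans (cong (_- y) eq) (solve 1 (λ y → con (+ 0) :- y := :- y :+ con (+ 0)) refl y)))
        (begin
          g x + α * g z
            ≡⟨ solve 4 (λ x y z α → x :+ α :* z := (con (+ 1) :* x :+ con (+ 1) :* y :+ α :* z) :- y) refl (g x) (g y) (g z) α ⟩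
          (1# * g x + 1# * g y + α * g z) - g y
            ≡⟨ cong (_- g y) geq ⟩
          0# - g y
            ≡⟨ solve 2 (λ y α → con (+ 0) :- y := :- y :+ α :* con (+ 0)) refl (g y) α ⟩
          - g y + α * 0#
            ≡⟨ cong₂ (λ s t → s + α * t) (g-neg y) g-0 ⟨
          g (- y) + α * g 0# ∎))
      mixed′ : ∀ x y z → x + y + z ≡ 0# → α * g x + α * g y + 1# * g z ≡ 0# → z ≡ 0#
      mixed′ x y z eq geq = proj₁ (Φ-injective {z} {x} {0#} { - y}
        (trans (solve 3 (λ x y z → z :+ x := (x :+ y :+ z) :- y) refl x y z)
          (trans (cong (_- y) eq) (solve 1 (λ y → con (+ 0) :- y := con (+ 0) :+ :- y) refl y)))
        (begin
          g z + α * g x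
            ≡⟨ solve 4 (λ x y z α → z :+ α :* x := (α :* x :+ α :* y :+ con (+ 1) :* z) :- α :* y) refl (g x) (g y) (g z) α ⟩
          (α * g x + α * g y + 1# * g z) - α * g y
            ≡⟨ cong (_- α * g y) geq ⟩
          0# - α * g y
            ≡⟨ solve 2 (λ y α → con (+ 0) :- α :* y := con (+ 0) :+ α :* (:- y)) refl (g y) α ⟩
          0# + α * (- g y)
            ≡⟨ cong₂ (λ s t → s + α * t) g-0 (g-neg y) ⟨
          g 0# + α * g (- y) ∎))
      swap₂₃ : ∀ {x y z} → x + y + z ≡ 0# → x + z + y ≡ 0#
      swap₂₃ {x} {y} {z} eq = trans (solve 3 (λ x y z → x :+ z :+ y := x :+ y :+ z) refl x y z) eq
      rotate : ∀ {x y z} → x + y + z ≡ 0# → y + z + x ≡ 0#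
      rotate {x} {y} {z} eq = trans (solve 3 (λ x y z → y :+ z :+ x := x :+ y :+ z) refl x y z) eq
      go : ∀ {ω₁ ω₂ ω₃} → (ω₁ ≡ 1# ⊎ ω₁ ≡ α) → (ω₂ ≡ 1# ⊎ ω₂ ≡ α) → (ω₃ ≡ 1# ⊎ ω₃ ≡ α) →
        ω₁ * g a + ω₂ * g b + ω₃ * g c ≡ 0# → ω₁ ≡ ω₂ × a * σ b ≡ b * σ a
      go (inj₁ refl) (inj₁ refl) (inj₁ refl) geq = refl , g-collinear eq (cancel (0≢1 ∘ sym) geq)
      go (inj₂ refl) (inj₂ refl) (inj₂ refl) geq = refl , g-collinear eq (cancel α≢0 geq)
      go (inj₁ refl) (inj₁ refl) (inj₂ refl) geq = contradiction (mixed a b c eq geq) c≢0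
      go (inj₁ refl) (inj₂ refl) (inj₁ refl) geq = contradiction (mixed a c b (swap₂₃ eq) (swap₂₃ geq)) b≢0
      go (inj₂ refl) (inj₁ refl) (inj₁ refl) geq = contradiction (mixed b c a (rotate eq) (rotate geq)) a≢0
      go (inj₂ refl) (inj₂ refl) (inj₁ refl) geq = contradiction (mixed′ a b c eq geq) c≢0
      go (inj₂ refl) (inj₁ refl) (inj₂ refl) geq = contradiction (mixed′ a c b (swap₂₃ eq) (swap₂₃ geq)) b≢0
      go (inj₁ refl) (inj₂ refl) (inj₂ refl) geq = contradiction (mixed′ b c a (rotate eq) (rotate geq)) a≢0

    S⇒OnCone : ∀ {v} → S v → ∃[ ω ] ((ω ≡ 1# ⊎ ω ≡ α) × OnCone ω v)
    S⇒OnCone = [ (λ p → 1# , inj₁ refl , 𝒱⇒OnCone p) , (λ p → α , inj₂ refl , 𝒱⇒OnCone p) ]′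

    -- By homogeneity of `g`, nonzero coefficients are absorbed into the first coordinates, which
    -- leaves a relation with all coefficients 1 for `cone-collinear`.
    isCap : IsCap S
    isCap (x , x′) (y , y′) (z , z′) su sv sw u≁v u≁w v≁w (a , b , c , a∈K , b∈K , c∈K , abc≢0 , dep)
      with S⇒OnCone su | S⇒OnCone sv | S⇒OnCone sw
    ... | ω₁ , i₁ , x≢0 , refl | ω₂ , i₂ , y≢0 , refl | ω₃ , i₃ , z≢0 , refl =
      u≁v (same (cone-collinear i₁ i₂ i₃ (*-≢0 a≢0 x≢0) (*-≢0 b≢0 y≢0) (*-≢0 c≢0 z≢0) dep₁ dep-g))
      where
      dep₁ = proj₁ (,-injective dep)
      dep₂ = proj₂ (,-injective dep)

      scaled : ∀ {c} → InK c → ∀ ω x → ω * g (c * x) ≡ c * (ω * g x)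
      scaled {c} c∈K ω x = trans (cong (ω *_) (g-homogeneous c∈K x)) (solve 3 (λ ω c y → ω :* (c :* y) := c :* (ω :* y)) refl ω c (g x))

      dep-g : ω₁ * g (a * x) + ω₂ * g (b * y) + ω₃ * g (c * z) ≡ 0#
      dep-g = trans (cong₂ _+_ (cong₂ _+_ (scaled a∈K ω₁ x) (scaled b∈K ω₂ y)) (scaled c∈K ω₃ z)) dep₂

      drop₁ : ∀ {s} t u v → s ≡ 0# → s * t + u + v ≡ 0# → u + v ≡ 0#
      drop₁ t u v refl = trans (solve 3 (λ t u v → u :+ v := con (+ 0) :* t :+ u :+ v) refl t u v)
      drop₂ : ∀ {s} t u v → s ≡ 0# → u + s * t + v ≡ 0# → u + v ≡ 0#
      drop₂ t u v refl = trans (solve 3 (λ t u v → u :+ v := u :+ con (+ 0) :* t :+ v) refl t u v)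
      drop₃ : ∀ {s} t u v → s ≡ 0# → u + v + s * t ≡ 0# → u + v ≡ 0#
      drop₃ t u v refl = trans (solve 3 (λ t u v → u :+ v := u :+ v :+ con (+ 0) :* t) refl t u v)

      a≢0 : a ≢ 0#
      a≢0 a≡0 = v≁w (dependent-pair⇒∼ b∈K c∈K y≢0 z≢0 (λ (b≡0 , c≡0) → abc≢0 (a≡0 , b≡0 , c≡0))
        (drop₁ _ _ _ a≡0 dep₁) (drop₁ _ _ _ a≡0 dep₂))
      b≢0 : b ≢ 0#
      b≢0 b≡0 = u≁w (dependent-pair⇒∼ a∈K c∈K x≢0 z≢0 (λ (a≡0 , c≡0) → abc≢0 (a≡0 , b≡0 , c≡0))
        (drop₂ _ _ _ b≡0 dep₁) (drop₂ _ _ _ b≡0 dep₂))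
      c≢0 : c ≢ 0#
      c≢0 c≡0 = u≁v (dependent-pair⇒∼ a∈K b∈K x≢0 y≢0 (λ (a≡0 , b≡0) → abc≢0 (a≡0 , b≡0 , c≡0))
        (drop₃ _ _ _ c≡0 dep₁) (drop₃ _ _ _ c≡0 dep₂))

      same : ω₁ ≡ ω₂ × a * x * σ (b * y) ≡ b * y * σ (a * x) → (x , ω₁ * g x) ∼ (y , ω₂ * g y)
      same (refl , eq) = σ-proportional⇒∼ x≢0 y≢0 (*-cancelˡ (*-≢0 a≢0 b≢0) (begin
        a * b * (x * σ y)          ≡⟨ solve 4 (λ a b x t → a :* b :* (x :* t) := a :* x :* (b :* t)) refl a b x (σ y) ⟩
        a * x * (b * σ y)          ≡⟨ cong (a * x *_) (trans (σ-* b y) (cong (_* σ y) b∈K)) ⟨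
        a * x * σ (b * y)          ≡⟨ eq ⟩
        b * y * σ (a * x)          ≡⟨ cong (b * y *_) (trans (σ-* a x) (cong (_* σ x) a∈K)) ⟩
        b * y * (a * σ x)          ≡⟨ solve 4 (λ a b y t → b :* y :* (a :* t) := a :* b :* (y :* t)) refl a b y (σ x) ⟩
        a * b * (y * σ x)          ∎))

    -- Take `w = Φ (a , b)`. If just one of `a`, `b` is 0, then `w` is already over one of the sets;
    -- if neither is, `w` is collinear with the points given by `a` and `b`.
    isComplete : ∀ w → w ≢ zeroV → ¬ (∃[ s ] (S s × s ∼ w)) → ¬ IsCap (λ v → S v ⊎ w ∼ v)
    isComplete w w≢0 w∉S cap with Φ-surjective w
    ... | a , b , refl with a ≟ 0# | b ≟ 0#
    ...   | yes refl | yes refl = w≢0 (cong₂ _,_ (+-identityˡ 0#) (trans (cong₂ (λ s t → s + α * t) g-0 g-0)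
              (solve 1 (λ α → con (+ 0) :+ α :* con (+ 0) := con (+ 0)) refl α)))
    ...   | yes refl | no b≢0 = w∉S (_ , inj₂ (OnCone⇒𝒱 (b≢0 , refl)) ,
              subst ((b , α * g b) ∼_) (cong₂ _,_ (sym (+-identityˡ b)) (sym (trans (cong (_+ α * g b) g-0) (+-identityˡ _)))) (∼-refl _))
    ...   | no a≢0 | yes refl = w∉S (_ , inj₁ (OnCone⇒𝒱 (a≢0 , refl)) ,
              subst ((a , 1# * g a) ∼_) (cong₂ _,_ (sym (+-identityʳ a))
                (trans (*-identityˡ (g a)) (sym (trans (cong (λ t → g a + α * t) g-0) (solve 2 (λ x α → x :+ α :* con (+ 0) := x) refl (g a) α))))) (∼-refl _))
    ...   | no a≢0 | no b≢0 = cap (a , 1# * g a) (b , α * g b) (Φ (a , b)) (inj₁ u∈S) (inj₁ v∈S) (inj₂ (∼-refl _))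
              (cones-≁ a≢0) (λ u∼w → w∉S (_ , u∈S , u∼w)) (λ v∼w → w∉S (_ , v∈S , v∼w))
              -- The coefficients 1, 1, -1 express `w = u + v`.
              (1# , 1# , - 1# , σ-1 , σ-1 , InK-neg σ-1 , (λ (1≡0 , _) → 0≢1 (sym 1≡0)) , cong₂ _,_
                (solve 2 (λ a b → con (+ 1) :* a :+ con (+ 1) :* b :+ (:- con (+ 1)) :* (a :+ b) := con (+ 0)) refl a b)
                (solve 2 (λ a b → con (+ 1) :* (con (+ 1) :* a) :+ con (+ 1) :* b :+ (:- con (+ 1)) :* (a :+ b) := con (+ 0)) refl (g a) (α * g b)))
      where
      u∈S : S (a , 1# * g a)
      u∈S = inj₁ (OnCone⇒𝒱 (a≢0 , refl))
      v∈S : S (b , α * g b)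
      v∈S = inj₂ (OnCone⇒𝒱 (b≢0 , refl))

    isCompleteCap : IsCompleteCap S
    isCompleteCap = isCap , isComplete

    -- Counting the points.

    hasPoints : ∀ {r′} → r ≡ suc r′ → ∃[ k ] (HasPoints S k × k ℕ.* r ≡ 2 ℕ.* (q ℕ.^ (2 ℕ.* n ℕ.+ 1) ℕ.∸ 1))
    hasPoints {r′} r≡1+r′ = _ , (map u₁ reps ++ map uα reps , refl , All.++⁺ (All.map⁺ (All.map u₁∈S reps≢0)) (All.map⁺ (All.map uα∈S reps≢0)) ,
        AllPairs.++⁺ (pairs 1# (0≢1 ∘ sym)) (pairs α α≢0)
          (All.map⁺ (All.map (λ a≢0 → All.map⁺ (All.universal (λ b → cones-≁ a≢0) reps)) reps≢0)) ,
        (λ v → [ (λ p → Any.++⁺ˡ (Any.map⁺ (covers (𝒱⇒OnCone p)))) , (λ p → Any.++⁺ʳ (map u₁ reps) (Any.map⁺ (covers (𝒱⇒OnCone p)))) ]′)) ,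
      (begin
        length (map u₁ reps ++ map uα reps) ℕ.* r
          ≡⟨ cong (ℕ._* r) (trans (List.length-++ (map u₁ reps)) (cong₂ ℕ._+_ (List.length-map u₁ reps) (List.length-map uα reps))) ⟩
        (length reps ℕ.+ length reps) ℕ.* r
          ≡⟨ cong (λ l → (l ℕ.+ l) ℕ.* r) length-reps ⟩
        (θ ℕ.+ θ) ℕ.* r
          ≡⟨ cong (λ l → (θ ℕ.+ l) ℕ.* r) (ℕ.+-identityʳ θ) ⟨
        2 ℕ.* θ ℕ.* r
          ≡⟨ trans (ℕ.*-assoc 2 θ r) (cong (2 ℕ.*_) (ℕ.*-comm θ r)) ⟩
        2 ℕ.* (r ℕ.* θ)
          ≡⟨ cong (λ k → 2 ℕ.* (k ℕ.∸ 1)) card-1≡ ⟨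
        2 ℕ.* (q ℕ.^ (2 ℕ.* n ℕ.+ 1) ℕ.∸ 1) ∎)
      where
      θ = suc (2 ℕ.* d)

      u₁ uα : Carrier → V
      u₁ a = a , 1# * g a
      uα a = a , α * g a

      u₁∈S : ∀ {a} → a ≢ 0# → S (u₁ a)
      u₁∈S a≢0 = inj₁ (OnCone⇒𝒱 (a≢0 , refl))

      uα∈S : ∀ {a} → a ≢ 0# → S (uα a)
      uα∈S a≢0 = inj₂ (OnCone⇒𝒱 (a≢0 , refl))

      class? : ∀ a b → Dec (a ^ r ≡ b ^ r)
      class? a b = (a ^ r) ≟ (b ^ r)

      -- One representative for each coset of K* in F*: nonzero `a` and `b` are K-proportional
      -- exactly when `a ^ r = b ^ r`.
      reps : List Carrier
      reps = deduplicate class? nonzeros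

      reps≢0 : All (_≢ 0#) reps
      reps≢0 = All.deduplicate⁺ class? (All.tabulate ∈-nonzeros⁻)

      reps-distinct : AllPairs (λ a b → a ^ r ≢ b ^ r) reps
      reps-distinct = UniqueDecSetoid.deduplicate-! (On.decSetoid (decSetoid _≟_) (_^ r)) nonzeros

      reps-cover : ∀ {a} → a ≢ 0# → Any (λ b → b ^ r ≡ a ^ r) reps
      reps-cover {a} a≢0 = Any.deduplicate⁺ class? (λ eq eq′ → trans eq eq′) (Any.map (λ a≡b → cong (_^ r) (sym a≡b)) (∈-nonzeros⁺ a≢0))

      class-σ : ∀ {a b} → a ^ r ≡ b ^ r → a * σ b ≡ b * σ a
      class-σ {a} {b} eq = begin
        a * (b * b ^ r)      ≡⟨ cong (λ t → a * (b * t)) eq ⟨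
        a * (b * a ^ r)      ≡⟨ solve 3 (λ a b t → a :* (b :* t) := b :* (a :* t)) refl a b (a ^ r) ⟩
        b * (a * a ^ r)      ∎

      InK⇒^r≡1 : ∀ {c} → InK c → c ≢ 0# → c ^ r ≡ 1#
      InK⇒^r≡1 {c} c∈K c≢0 = *-cancelˡ c≢0 (trans c∈K (sym (*-identityʳ c)))

      covers : ∀ {ω v} → OnCone ω v → Any (λ a → (a , ω * g a) ∼ v) reps
      covers {ω} {b , _} (b≢0 , refl) = Any.map (λ (a≢0 , eq) → σ-proportional⇒∼ a≢0 b≢0 (class-σ eq))
        (All-Any reps≢0 (reps-cover b≢0))
        where
        All-Any : ∀ {P Q : Carrier → Set} {xs} → All P xs → Any Q xs → Any (λ x → P x × Q x) xs
        All-Any (p ∷ _)  (here q′)  = here (p , q′)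
        All-Any (_ ∷ ps) (there qs) = there (All-Any ps qs)

      pairs : ∀ ω → ω ≢ 0# → AllPairs (λ u v → ¬ (u ∼ v)) (map (λ a → a , ω * g a) reps)
      pairs ω ω≢0 = AllPairs.map⁺ (AllPairs.map (λ {a} {b} a^r≢b^r (c , c∈K , c≢0 , eq) → a^r≢b^r (begin
        a ^ r              ≡⟨ *-identityˡ _ ⟨
        1# * a ^ r         ≡⟨ cong (_* a ^ r) (InK⇒^r≡1 c∈K c≢0) ⟨
        c ^ r * a ^ r      ≡⟨ ^-distrib-* c a r ⟨
        (c * a) ^ r        ≡⟨ cong (_^ r) (proj₁ (,-injective eq)) ⟨
        b ^ r              ∎)) reps-distinct)

      -- The values `a ^ r` at the representatives are distinct roots of `x ^ θ = 1`.
      length-reps≤θ : length reps ℕ.≤ θ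
      length-reps≤θ = subst (ℕ._≤ θ) (List.length-map (_^ r) reps)
        (#x^d≡c≤d (2 ℕ.* d) 1# (AllPairs.map⁺ reps-distinct) (All.map⁺ (All.map (λ {a} a≢0 → begin
          (a ^ r) ^ θ            ≡⟨ ^-assocʳ a r θ ⟩
          a ^ (r ℕ.* θ)          ≡⟨ cong (a ^_) length-nonzeros≡ ⟨
          a ^ length nonzeros    ≡⟨ fermat a≢0 ⟩
          1#                     ∎) reps≢0)))
        where
        length-nonzeros≡ : length nonzeros ≡ r ℕ.* θ
        length-nonzeros≡ = ℕ.suc-injective (trans length-nonzeros (trans card≡ card-1≡))

      -- The `r θ` nonzero elements are distributed over the classes, each of at most `r` elements.
      θ≤length-reps : θ ℕ.≤ length reps
      θ≤length-reps = ℕ.*-cancelʳ-≤ θ (length reps) r ⦃ subst ℕ.NonZero (sym r≡1+r′) _ ⦄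
        (subst (ℕ._≤ length reps ℕ.* r) (trans (ℕ.suc-injective (trans length-nonzeros (trans card≡ card-1≡))) (ℕ.*-comm r θ))
          (length≤cover (λ b a → class? b a) r class-small reps nonzeros-unique (All.tabulate (λ a∈ → reps-cover (∈-nonzeros⁻ a∈)))))
        where
        class-small : ∀ b {xs} → Unique xs → All (λ a → b ^ r ≡ a ^ r) xs → length xs ℕ.≤ r
        class-small b {xs} uxs eqs = subst (length xs ℕ.≤_) (sym r≡1+r′)
          (#x^d≡c≤d r′ (b ^ r) uxs (All.map (λ {a} eq → trans (cong (a ^_) (sym r≡1+r′)) (sym eq)) eqs))

      length-reps : length reps ≡ θ
      length-reps = ℕ.≤-antisym length-reps≤θ θ≤length-reps

-- Arithmetic of `q`, the parity of the characteristic, and `α`.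

consecutive-product-even : ∀ r → ∃[ t ] suc r ℕ.* suc (suc r) ≡ 2 ℕ.* t
consecutive-product-even zero = 1 , refl
consecutive-product-even (suc r) with consecutive-product-even r
... | t , eq = t ℕ.+ suc (suc r) , (begin
  suc (suc r) ℕ.* suc (suc (suc r))                ≡⟨ solve 1 (λ r → (con 2 :+ r) :* (con 3 :+ r) := (con 1 :+ r) :* (con 2 :+ r) :+ con 2 :* (con 2 :+ r)) refl r ⟩
  suc r ℕ.* suc (suc r) ℕ.+ 2 ℕ.* suc (suc r)      ≡⟨ cong (ℕ._+ 2 ℕ.* suc (suc r)) eq ⟩
  2 ℕ.* t ℕ.+ 2 ℕ.* suc (suc r)                    ≡⟨ ℕ.*-distribˡ-+ 2 t (suc (suc r)) ⟨
  2 ℕ.* (t ℕ.+ suc (suc r))                        ∎)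
  where open ≡-Reasoning
        open +-*-Solver

-- Raising the exponent by 2 replaces `θ = 1 + 2d` by `q² θ + q + 1 = 1 + q (q + 1) + 2 q² d`, which
-- is again odd because `q (q + 1)` is even.
odd-cofactor : ∀ r n → ∃[ d ] suc r ℕ.^ (2 ℕ.* n ℕ.+ 1) ≡ suc (r ℕ.* suc (2 ℕ.* d))
odd-cofactor r zero = 0 , cong suc refl
odd-cofactor r (suc n) with odd-cofactor r n | consecutive-product-even r
... | d , eq | t , t-eq = t ℕ.+ Q ℕ.* Q ℕ.* d , (begin
  Q ℕ.^ (2 ℕ.* suc n ℕ.+ 1)                          ≡⟨ cong (Q ℕ.^_) (solve 1 (λ n → con 2 :* (con 1 :+ n) :+ con 1 := con 2 :+ (con 2 :* n :+ con 1)) refl n) ⟩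
  Q ℕ.* (Q ℕ.* Q ℕ.^ (2 ℕ.* n ℕ.+ 1))                ≡⟨ cong (λ k → Q ℕ.* (Q ℕ.* k)) eq ⟩
  Q ℕ.* (Q ℕ.* suc (r ℕ.* suc (2 ℕ.* d)))            ≡⟨ solve 2 (λ r d → (con 1 :+ r) :* ((con 1 :+ r) :* (con 1 :+ r :* (con 1 :+ con 2 :* d)))
                                                          := con 1 :+ r :* (con 1 :+ ((con 1 :+ r) :* (con 2 :+ r) :+ con 2 :* ((con 1 :+ r) :* (con 1 :+ r) :* d)))) refl r d ⟩
  suc (r ℕ.* suc (Q ℕ.* suc Q ℕ.+ 2 ℕ.* (Q ℕ.* Q ℕ.* d)))   ≡⟨ cong (λ k → suc (r ℕ.* suc (k ℕ.+ 2 ℕ.* (Q ℕ.* Q ℕ.* d)))) t-eq ⟩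
  suc (r ℕ.* suc (2 ℕ.* t ℕ.+ 2 ℕ.* (Q ℕ.* Q ℕ.* d)))       ≡⟨ cong (λ k → suc (r ℕ.* suc k)) (ℕ.*-distribˡ-+ 2 t (Q ℕ.* Q ℕ.* d)) ⟨
  suc (r ℕ.* suc (2 ℕ.* (t ℕ.+ Q ℕ.* Q ℕ.* d)))             ∎)
  where
  Q = suc r
  open ≡-Reasoning
  open +-*-Solver

remainder-mod-2 : ∀ q → q ℕ.% 2 ≡ 0 ⊎ q ℕ.% 2 ≡ 1
remainder-mod-2 q with q ℕ.% 2 | m%n<n q 2
... | 0 | _ = inj₁ refl
... | 1 | _ = inj₂ refl
... | suc (suc _) | ℕ.s≤s (ℕ.s≤s ())

module Parameters (F : FiniteField) (r n : ℕ) (q-primePower : IsPrimePower (suc r))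
  (card≡ : FiniteField.card F ≡ suc r ℕ.^ (2 ℕ.* n ℕ.+ 1))
  where
  open FiniteField F
  open FieldProperties F
  private
    q = suc r
    p = proj₁ q-primePower
    k = proj₁ (proj₂ q-primePower)
    q≡p^1+k : q ≡ p ℕ.^ suc k
    q≡p^1+k = proj₂ (proj₂ (proj₂ q-primePower))

  open Characteristic {p} (proj₁ (proj₂ (proj₂ q-primePower))) {suc k ℕ.* (2 ℕ.* n ℕ.+ 1)}
    (trans card≡ (trans (cong (ℕ._^ (2 ℕ.* n ℕ.+ 1)) q≡p^1+k) (ℕ.^-*-assoc p (suc k) (2 ℕ.* n ℕ.+ 1))))

  σ-+ : PowerAdditive F q
  σ-+ = subst (PowerAdditive F) (sym q≡p^1+k) (frobenius^-+ (suc k))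

  open OddExtension F r (proj₁ (odd-cofactor r n)) n σ-+ card≡ (proj₂ (odd-cofactor r n)) using (InK; σ-1; σ-neg; InK-neg)

  -- As `p` divides `q`, the multiple `q ⊠ 1#` is 0; with `q` odd and 2 = 0 it would be 1.
  odd⇒2≢0 : q ℕ.% 2 ≡ 1 → 1# + 1# ≢ 0#
  odd⇒2≢0 q%2≡1 2≡0 = 0≢1 (begin
    0#                                                  ≡⟨ p∣n⇒n⊠≡0 (subst (p ∣_) (sym q≡p^1+k) (m∣m*n (p ℕ.^ k))) 1# ⟨
    q ⊠ 1#                                              ≡⟨ cong (_⊠ 1#) (trans (m≡m%n+[m/n]*n q 2) (cong (ℕ._+ q ℕ./ 2 ℕ.* 2) q%2≡1)) ⟩
    1# + (q ℕ./ 2 ℕ.* 2) ⊠ 1#                           ≡⟨ cong (_+_ 1#) (×1-homo-* (q ℕ./ 2) 2) ⟩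
    1# + (q ℕ./ 2) ⊠ 1# * (1# + (1# + 0#))              ≡⟨ cong (λ t → 1# + (q ℕ./ 2) ⊠ 1# * t) (trans (cong (_+_ 1#) (+-identityʳ 1#)) 2≡0) ⟩
    1# + (q ℕ./ 2) ⊠ 1# * 0#                            ≡⟨ trans (cong (_+_ 1#) (zeroʳ _)) (+-identityʳ 1#) ⟩
    1#                                                  ∎)
    where open ≡-Reasoning

  -- For even q, Frobenius sends −1 both to −1 and to (−1)^q = 1.
  even⇒2≡0 : q ℕ.% 2 ≡ 0 → 1# + 1# ≡ 0#
  even⇒2≡0 q%2≡0 = begin
    1# + 1#                            ≡⟨ cong (_+ 1#) (-1^even (q ℕ./ 2)) ⟨
    (- 1#) ^ (q ℕ./ 2 ℕ.* 2) + 1#      ≡⟨ cong (λ k → (- 1#) ^ k + 1#) (trans (m≡m%n+[m/n]*n q 2) (cong (ℕ._+ q ℕ./ 2 ℕ.* 2) q%2≡0)) ⟨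
    (- 1#) ^ q + 1#                    ≡⟨ cong (_+ 1#) (InK-neg σ-1) ⟩
    - 1# + 1#                          ≡⟨ -‿inverseˡ 1# ⟩
    0#                                 ∎
    where
    open ≡-Reasoning
    -1^even : ∀ j → (- 1#) ^ (j ℕ.* 2) ≡ 1#
    -1^even zero    = refl
    -1^even (suc j) = trans (solve 1 (λ x → (:- con (+ 1)) :* ((:- con (+ 1)) :* x) := x) refl _) (-1^even j)

  α-properties : ∀ {α} → Geometry.AlphaOK F q α →
    InK α × α ≢ 0# × α ≢ 1# × ((1# + 1# ≢ 0# × α ≡ - 1#) ⊎ 1# + 1# ≡ 0#)
  α-properties (odd , even) with remainder-mod-2 q
  ... | inj₁ q%2≡0 = let α∈K , α≢0 , α≢1 = even q%2≡0 in α∈K , α≢0 , α≢1 , inj₂ (even⇒2≡0 q%2≡0)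
  ... | inj₂ q%2≡1 with odd q%2≡1
  ...   | refl = InK-neg σ-1 , neg-≢0 (0≢1 ∘ sym) ,
    (λ -1≡1 → odd⇒2≢0 q%2≡1 (trans (cong (_+_ 1#) (sym -1≡1)) (-‿inverseʳ 1#))) , inj₁ (odd⇒2≢0 q%2≡1 , refl)

open import Data.Nat using (_+_; _*_; _∸_; _^_; _<_; _≤_)

theorem3p7 : (q n : ℕ) → IsPrimePower q → 2 < q → 1 ≤ n →
    (F : FiniteField) → FiniteField.card F ≡ q ^ (2 * n + 1) →
    (α : FiniteField.Carrier F) → Geometry.AlphaOK F q α →
    Geometry.IsCompleteCap F q (λ v → Geometry.𝒱 F q (FiniteField.1# F) v ⊎ Geometry.𝒱 F q α v)
    × (∃[ k ] (Geometry.HasPoints F q (λ v → Geometry.𝒱 F q (FiniteField.1# F) v ⊎ Geometry.𝒱 F q α v) k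
    × k * (q ∸ 1) ≡ 2 * (q ^ (2 * n + 1) ∸ 1)))
theorem3p7 1 _ _ (ℕ.s≤s ()) _ _ _ _ _
-- The parameter `q − 1` of the modules is `suc r` here, visibly nonzero as `hasPoints` requires.
theorem3p7 (suc (suc r)) n q-primePower _ _ F card≡ α α-ok =
  let α∈K , α≢0 , α≢1 , parity = α-properties α-ok
  in isCompleteCap α α∈K α≢0 α≢1 parity , hasPoints α α∈K α≢0 α≢1 parity refl
  where
  open Parameters F (suc r) n q-primePower card≡
  open Caps F (suc r) (proj₁ (odd-cofactor (suc r) n)) n σ-+ card≡ (proj₂ (odd-cofactor (suc r) n))
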